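{- For each integer $p\geq0$, there exists a unique polynomial $Q_p(b,j)$ such that $$\sum_{k=b}^{j-1}\binom{2k+1+p}{2p+1}\binom{2j-1}{j+k}=\binom{2j-1}{j+b}Q_p(b,j)\qquad\text{for integers }j>b\geq0,$$ $$\sum_{k=m}^{b-1}\binom{2k+1+p}{2p+1}(-1)^{k+m}\binom{k+m}{2m}=-(-1)^{b+m}\binom{b+m}{2m}Q_p(b,-m)\qquad\text{for integers }b>m\geq0.$$ The polynomial $Q_p(b,j)$ is of degree $2p+1$ in $b$ and degree $p+1$ in $j$ and satisfies $Q_p(b,-b)=0$. -}

module Defs where

open import Data.Nat.Base as ℕ using (ℕ; zero; suc; _∸_)
open import Data.Nat.Combinatorics using (_C_)
open import Data.Integer.Base as ℤ using (ℤ; +_; -1ℤ)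
open import Data.Rational.Base using (ℚ; 0ℚ; _+_; _*_; -_; _/_)
open import Data.List.Base using (List; []; _∷_; map; foldr; applyUpTo)
open import Data.Product.Base using (_×_; ∃-syntax)
open import Relation.Binary.PropositionalEquality.Core using (_≡_; _≢_)

fromℤ : ℤ → ℚ
fromℤ i = i / 1

fromℕ : ℕ → ℚ
fromℕ n = fromℤ (+ n)

-- The half-open sum f(lo) + … + f(hi - 1); empty when hi ≤ lo.
∑[_,_⟩ : ℕ → ℕ → (ℕ → ℚ) → ℚ
∑[ lo , hi ⟩ f = foldr _+_ 0ℚ (applyUpTo (λ i → f (lo ℕ.+ i)) (hi ∸ lo))

-- Polynomials in ℚ[b,j]: the entry at position k of the list at position i
-- is the coefficient of bⁱ jᵏ, and entries beyond the end of a list are zero.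
-- Trailing zeros are allowed, so equality of polynomials is _≈_, not _≡_.
Poly₂ : Set
Poly₂ = List (List ℚ)

nth : {A : Set} → A → List A → ℕ → A
nth d []       _       = d
nth d (x ∷ _)  zero    = x
nth d (_ ∷ xs) (suc n) = nth d xs n

coeff : Poly₂ → ℕ → ℕ → ℚ
coeff Q i k = nth 0ℚ (nth [] Q i) k

infix 4 _≈_
_≈_ : Poly₂ → Poly₂ → Set
P ≈ Q = ∀ i k → coeff P i k ≡ coeff Q i k

eval₁ : List ℚ → ℚ → ℚ
eval₁ q x = foldr (λ a r → a + x * r) 0ℚ q

-- Q ⟨ x , y ⟩ is the value of Q at b = x, j = y.
infix 8 _⟨_,_⟩
_⟨_,_⟩ : Poly₂ → ℚ → ℚ → ℚ
Q ⟨ x , y ⟩ = eval₁ (map (λ q → eval₁ q y) Q) x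

DegreeInB : Poly₂ → ℕ → Set
DegreeInB Q d = (∃[ k ] coeff Q d k ≢ 0ℚ) × (∀ i k → d ℕ.< i → coeff Q i k ≡ 0ℚ)

DegreeInJ : Poly₂ → ℕ → Set
DegreeInJ Q d = (∃[ i ] coeff Q i d ≢ 0ℚ) × (∀ i k → d ℕ.< k → coeff Q i k ≡ 0ℚ)

binom : ℕ → ℕ → ℚ
binom n k = fromℕ (n C k)

[-1]^_ : ℕ → ℚ
[-1]^ n = fromℤ (-1ℤ ℤ.^ n)

weight : ℕ → ℕ → ℚ
weight p k = binom (2 ℕ.* k ℕ.+ 1 ℕ.+ p) (2 ℕ.* p ℕ.+ 1)

-- The truncated 2j ∸ 1 is the true 2j - 1, since b < j forces j ≥ 1.
FirstIdentity : ℕ → Poly₂ → Set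
FirstIdentity p Q = ∀ (b j : ℕ) → b ℕ.< j →
  ∑[ b , j ⟩ (λ k → weight p k * binom (2 ℕ.* j ∸ 1) (j ℕ.+ k))
    ≡ binom (2 ℕ.* j ∸ 1) (j ℕ.+ b) * Q ⟨ fromℕ b , fromℕ j ⟩

SecondIdentity : ℕ → Poly₂ → Set
SecondIdentity p Q = ∀ (b m : ℕ) → m ℕ.< b →
  ∑[ m , b ⟩ (λ k → weight p k * ([-1]^ (k ℕ.+ m)) * binom (k ℕ.+ m) (2 ℕ.* m))
    ≡ - (([-1]^ (b ℕ.+ m)) * binom (b ℕ.+ m) (2 ℕ.* m) * Q ⟨ fromℕ b , - fromℕ m ⟩)

{-# OPTIONS --safe #-}

-- Both identities telescope. If t(k) is either of the two hypergeometric terms, with j = −m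
-- in the second one, then (k+1+j) t(k+1) = −(k+1−j) t(k). Putting Q = (b+j) P, both sums
-- therefore follow from the single polynomial equation
--   (b+j) P(b,j) + (b+1−j) P(b+1,j) = binom(2b+1+p, 2p+1),
-- with the boundary terms vanishing because binom(2j−1, 2j) = 0 and Q(m, −m) = 0.
-- The right-hand side is (2b+1) ∏_{1≤l≤p} ((2b+1)² − l²) / (2p+1)!. The operator on the left
-- (called gosper) sends e_i = ∏_{l<i} (b² − l²) (evenProduct) to (2b+1) (g_i + i (i−j) g_{i−1}),
-- where g_i = ∏_{l<i} (b−l)(b+l+1) (shiftProduct). This is triangular: (2b+1) g_i is the image
-- of R_i = e_i + i (j−i) R_{i−1} (basicSolution), and it remains to expand the weight in the
-- g_i. The coefficients of b^{2d} and j^d stay positive throughout, which gives the degrees.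
-- Uniqueness needs only the second identity: for each j = −m it fixes Q(b, −m) for all b > m.
module Submission where

module Construction where
  open import Defs
  open import Data.Nat.Base as ℕ using (ℕ; zero; suc; _∸_; _≤_; _<_; z≤n; s≤s)
  import Data.Nat.Properties as ℕ
  open import Data.Nat.Combinatorics using (_C_; nCk+nC[k+1]≡[n+1]C[k+1]; k>n⇒nCk≡0; nC1≡n)
  open import Data.Integer.Base as ℤ using (-1ℤ)
  import Data.Integer.Properties as ℤ
  open import Data.Rational.Base using (ℚ; 0ℚ; 1ℚ; -_; _+_; _*_; 1/_; toℚᵘ; Positive; ≢-nonZero)
  open import Data.Rational.Properties
  open import Data.Rational.Unnormalised.Base as ℚᵘ using (mkℚᵘ)
  import Data.Rational.Unnormalised.Properties as ℚᵘ
  open import Data.List.Base using (List; []; _∷_; map; foldr; applyUpTo; length)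
  open import Data.Product using (_,_)
  open import Function.Base using (_∘_)
  open import Function.Definitions using (Injective)
  open import Relation.Binary.PropositionalEquality
  open import Relation.Nullary.Decidable using (dec⇒maybe)
  open import Tactic.RingSolver using (solve-∀)
  open import Tactic.RingSolver.Core.AlmostCommutativeRing using (AlmostCommutativeRing; fromCommutativeRing)

  -- Rational arithmetic and the embeddings of ℤ and ℕ in ℚ.

  ℚ-ring : AlmostCommutativeRing _ _
  ℚ-ring = fromCommutativeRing +-*-commutativeRing (λ x → dec⇒maybe (0ℚ ≟ x))

  module _ where
    open ℚᵘ.≃-Reasoning

    -- Normalised fractions carry a gcd computation that is stuck for variable `i` and `j`. In
    -- unnormalised rationals the sum of two fractions over 1 is explicit, up to the factors 1 left
    -- by cross-multiplication.
    fromℤ-+ : ∀ i j → fromℤ (i ℤ.+ j) ≡ fromℤ i + fromℤ j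
    fromℤ-+ i j = toℚᵘ-injective (begin
      toℚᵘ (fromℤ (i ℤ.+ j))
        ≈⟨ toℚᵘ-fromℚᵘ (mkℚᵘ (i ℤ.+ j) 0) ⟩
      mkℚᵘ (i ℤ.+ j) 0
        ≡⟨ cong (λ n → mkℚᵘ n 0) (cong₂ ℤ._+_ (ℤ.*-identityʳ i) (ℤ.*-identityʳ j)) ⟨
      mkℚᵘ i 0 ℚᵘ.+ mkℚᵘ j 0
        ≈⟨ ℚᵘ.+-cong (toℚᵘ-fromℚᵘ (mkℚᵘ i 0)) (toℚᵘ-fromℚᵘ (mkℚᵘ j 0)) ⟨
      toℚᵘ (fromℤ i) ℚᵘ.+ toℚᵘ (fromℤ j)
        ≈⟨ toℚᵘ-homo-+ (fromℤ i) (fromℤ j) ⟨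
      toℚᵘ (fromℤ i + fromℤ j) ∎)

    fromℤ-* : ∀ i j → fromℤ (i ℤ.* j) ≡ fromℤ i * fromℤ j
    fromℤ-* i j = toℚᵘ-injective (begin
      toℚᵘ (fromℤ (i ℤ.* j))              ≈⟨ toℚᵘ-fromℚᵘ (mkℚᵘ (i ℤ.* j) 0) ⟩
      mkℚᵘ i 0 ℚᵘ.* mkℚᵘ j 0              ≈⟨ ℚᵘ.*-cong (toℚᵘ-fromℚᵘ (mkℚᵘ i 0)) (toℚᵘ-fromℚᵘ (mkℚᵘ j 0)) ⟨
      toℚᵘ (fromℤ i) ℚᵘ.* toℚᵘ (fromℤ j)  ≈⟨ toℚᵘ-homo-* (fromℤ i) (fromℤ j) ⟨
      toℚᵘ (fromℤ i * fromℤ j)            ∎)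

  open ≡-Reasoning

  *-cancelˡ-≢0 : ∀ r {a b} → r ≢ 0ℚ → r * a ≡ r * b → a ≡ b
  *-cancelˡ-≢0 r {a} {b} r≢0 eq = begin
    a               ≡⟨ undo a ⟩
    1/ r * (r * a)  ≡⟨ cong (1/ r *_) eq ⟩
    1/ r * (r * b)  ≡⟨ undo b ⟨
    b               ∎
    where
    instance r-nonZero = ≢-nonZero r≢0
    undo : ∀ c → c ≡ 1/ r * (r * c)
    undo c = begin
      c               ≡⟨ *-identityˡ c ⟨
      1ℚ * c          ≡⟨ cong (_* c) (*-inverseˡ r) ⟨
      1/ r * r * c    ≡⟨ *-assoc (1/ r) r c ⟩
      1/ r * (r * c)  ∎

  x-y≡0⇒x≡y : ∀ x y → x + - y ≡ 0ℚ → x ≡ y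
  x-y≡0⇒x≡y x y eq = begin
    x            ≡⟨ split x y ⟩
    x + - y + y  ≡⟨ cong (_+ y) eq ⟩
    0ℚ + y       ≡⟨ +-identityˡ y ⟩
    y            ∎
    where
    split : ∀ x y → x ≡ x + - y + y
    split = solve-∀ ℚ-ring

  positive⇒≢0 : ∀ r → Positive r → r ≢ 0ℚ
  positive⇒≢0 r () refl

  fromℕ-+ : ∀ m n → fromℕ (m ℕ.+ n) ≡ fromℕ m + fromℕ n
  fromℕ-+ m n = fromℤ-+ (ℤ.+ m) (ℤ.+ n)

  fromℕ-suc : ∀ n → fromℕ (suc n) ≡ fromℕ n + 1ℚ
  fromℕ-suc n = trans (fromℕ-+ 1 n) (+-comm 1ℚ (fromℕ n))

  fromℕ-2* : ∀ n → fromℕ (2 ℕ.* n) ≡ fromℕ n + fromℕ n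
  fromℕ-2* n = trans (cong (λ k → fromℕ (n ℕ.+ k)) (ℕ.+-identityʳ n)) (fromℕ-+ n n)

  fromℕ-injective : Injective _≡_ _≡_ fromℕ
  fromℕ-injective {m} {n} eq with fromℚᵘ-injective {mkℚᵘ (ℤ.+ m) 0} {mkℚᵘ (ℤ.+ n) 0} eq
  ... | ℚᵘ.*≡* m≡n = ℤ.+-injective (ℤ.*-cancelʳ-≡ (ℤ.+ m) (ℤ.+ n) (ℤ.+ 1) m≡n)

  fromℕ-suc-positive : ∀ n → Positive (fromℕ (suc n))
  fromℕ-suc-positive n = normalize-pos (suc n) 1

  [-1]^-suc : ∀ n → [-1]^ suc n ≡ - 1ℚ * [-1]^ n
  [-1]^-suc n = fromℤ-* -1ℤ (-1ℤ ℤ.^ n)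

  [-1]^-square : ∀ n → [-1]^ n * [-1]^ n ≡ 1ℚ
  [-1]^-square zero = refl
  [-1]^-square (suc n) = begin
    [-1]^ suc n * [-1]^ suc n          ≡⟨ cong₂ _*_ ([-1]^-suc n) ([-1]^-suc n) ⟩
    - 1ℚ * [-1]^ n * (- 1ℚ * [-1]^ n)  ≡⟨ signs ([-1]^ n) ⟩
    [-1]^ n * [-1]^ n                  ≡⟨ [-1]^-square n ⟩
    1ℚ                                 ∎
    where
    signs : ∀ s → - 1ℚ * s * (- 1ℚ * s) ≡ s * s
    signs = solve-∀ ℚ-ring

  [-1]^≢0 : ∀ n → [-1]^ n ≢ 0ℚ
  [-1]^≢0 n eq = 1≢0 (trans (sym ([-1]^-square n)) (cong₂ _*_ eq eq))

  -- Recurrences between neighbouring binomial coefficients.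

  binom-pascal : ∀ n k → binom (suc n) (suc k) ≡ binom n k + binom n (suc k)
  binom-pascal n k = trans (cong fromℕ (sym (nCk+nC[k+1]≡[n+1]C[k+1] n k))) (fromℕ-+ (n C k) (n C suc k))

  -- Induction on `n` by Pascal's rule. The difference n - k is taken in ℚ and may be negative; for
  -- k > n both binomials are zero. This is the term ratio behind the first identity.
  binom-raise : ∀ n k → (fromℕ k + 1ℚ) * binom n (suc k) ≡ (fromℕ n + - fromℕ k) * binom n k
  binom-raise zero zero = refl
  binom-raise zero (suc k) = trans (*-zeroʳ (fromℕ (suc k) + 1ℚ)) (sym (*-zeroʳ (0ℚ + - fromℕ (suc k))))
  binom-raise (suc n) zero = begin
    1ℚ * binom (suc n) 1         ≡⟨ cong (1ℚ *_) (binom-pascal n 0) ⟩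
    1ℚ * (1ℚ + binom n 1)        ≡⟨ *-distribˡ-+ 1ℚ 1ℚ (binom n 1) ⟩
    1ℚ + 1ℚ * binom n 1          ≡⟨ cong (λ y → 1ℚ + y) (binom-raise n 0) ⟩
    1ℚ + (fromℕ n + - 0ℚ) * 1ℚ   ≡⟨ regroup (fromℕ n) ⟩
    (fromℕ n + 1ℚ + - 0ℚ) * 1ℚ   ≡⟨ cong (λ x → (x + - 0ℚ) * 1ℚ) (fromℕ-suc n) ⟨
    (fromℕ (suc n) + - 0ℚ) * 1ℚ  ∎
    where
    regroup : ∀ x → 1ℚ + (x + - 0ℚ) * 1ℚ ≡ (x + 1ℚ + - 0ℚ) * 1ℚ
    regroup = solve-∀ ℚ-ring
  binom-raise (suc n) (suc k) = begin
    (fromℕ (suc k) + 1ℚ) * binom (suc n) (suc (suc k))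
      ≡⟨ cong₂ (λ u v → (u + 1ℚ) * v) (fromℕ-suc k) (binom-pascal n (suc k)) ⟩
    (κ + 1ℚ + 1ℚ) * (Y + Z)
      ≡⟨ regroup₁ κ Y Z ⟩
    (κ + 1ℚ) * Y + Y + (κ + 1ℚ + 1ℚ) * Z
      ≡⟨ cong₂ (λ u v → u + Y + v) (binom-raise n k) raise-suc ⟩
    (ν + - κ) * X + Y + (ν + - (κ + 1ℚ)) * Y
      ≡⟨ regroup₂ ν κ X Y ⟩
    (ν + 1ℚ + - (κ + 1ℚ)) * (X + Y)
      ≡⟨ cong₂ _*_ (cong₂ (λ u v → u + - v) (fromℕ-suc n) (fromℕ-suc k)) (binom-pascal n k) ⟨
    (fromℕ (suc n) + - fromℕ (suc k)) * binom (suc n) (suc k) ∎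
    where
    ν = fromℕ n
    κ = fromℕ k
    X = binom n k
    Y = binom n (suc k)
    Z = binom n (suc (suc k))
    raise-suc : (κ + 1ℚ + 1ℚ) * Z ≡ (ν + - (κ + 1ℚ)) * Y
    raise-suc = subst (λ u → (u + 1ℚ) * Z ≡ (ν + - u) * Y) (fromℕ-suc k) (binom-raise n (suc k))
    regroup₁ : ∀ κ Y Z → (κ + 1ℚ + 1ℚ) * (Y + Z) ≡ (κ + 1ℚ) * Y + Y + (κ + 1ℚ + 1ℚ) * Z
    regroup₁ = solve-∀ ℚ-ring
    regroup₂ : ∀ ν κ X Y → (ν + - κ) * X + Y + (ν + - (κ + 1ℚ)) * Y ≡ (ν + 1ℚ + - (κ + 1ℚ)) * (X + Y)
    regroup₂ = solve-∀ ℚ-ring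

  binom-absorb : ∀ n k → (fromℕ k + 1ℚ) * binom (suc n) (suc k) ≡ (fromℕ n + 1ℚ) * binom n k
  binom-absorb n k = begin
    (κ + 1ℚ) * binom (suc n) (suc k)  ≡⟨ cong ((κ + 1ℚ) *_) (binom-pascal n k) ⟩
    (κ + 1ℚ) * (X + Y)                ≡⟨ *-distribˡ-+ (κ + 1ℚ) X Y ⟩
    (κ + 1ℚ) * X + (κ + 1ℚ) * Y       ≡⟨ cong (λ y → (κ + 1ℚ) * X + y) (binom-raise n k) ⟩
    (κ + 1ℚ) * X + (ν + - κ) * X      ≡⟨ regroup ν κ X ⟩
    (ν + 1ℚ) * X                      ∎
    where
    ν = fromℕ n
    κ = fromℕ k
    X = binom n k
    Y = binom n (suc k)
    regroup : ∀ ν κ X → (κ + 1ℚ) * X + (ν + - κ) * X ≡ (ν + 1ℚ) * X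
    regroup = solve-∀ ℚ-ring

  -- Eliminates C(n+1, k+1) between `binom-raise` at n + 1 and `binom-absorb`. In the second
  -- identity the summation index sits in the upper argument, so this form gives its term ratio.
  binom-extend : ∀ n k → (fromℕ n + 1ℚ + - fromℕ k) * binom (suc n) k ≡ (fromℕ n + 1ℚ) * binom n k
  binom-extend n k = begin
    (fromℕ n + 1ℚ + - fromℕ k) * binom (suc n) k
      ≡⟨ cong (λ u → (u + - fromℕ k) * binom (suc n) k) (fromℕ-suc n) ⟨
    (fromℕ (suc n) + - fromℕ k) * binom (suc n) k
      ≡⟨ binom-raise (suc n) k ⟨
    (fromℕ k + 1ℚ) * binom (suc n) (suc k)
      ≡⟨ binom-absorb n k ⟩
    (fromℕ n + 1ℚ) * binom n k ∎

  nCk>0 : ∀ {n k} → k ≤ n → 0 < n C k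
  nCk>0 {n} z≤n = s≤s z≤n
  nCk>0 {suc n} {suc k} (s≤s k≤n) = subst (0 <_) (nCk+nC[k+1]≡[n+1]C[k+1] n k) (ℕ.≤-trans (nCk>0 k≤n) (ℕ.m≤m+n (n C k) _))

  binom≢0 : ∀ {n k} → k ≤ n → binom n k ≢ 0ℚ
  binom≢0 k≤n eq = ℕ.<⇒≢ (nCk>0 k≤n) (sym (fromℕ-injective eq))

  binom≡0 : ∀ {n k} → n < k → binom n k ≡ 0ℚ
  binom≡0 n<k = cong fromℕ (k>n⇒nCk≡0 n<k)

  -- Telescoping sums.

  sum-telescope : ∀ n (G g : ℕ → ℚ) → (∀ k → g k ≡ G k + - G (suc k)) →
                  foldr _+_ 0ℚ (applyUpTo g n) ≡ G 0 + - G n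
  sum-telescope zero G g step = sym (+-inverseʳ (G 0))
  sum-telescope (suc n) G g step = begin
    g 0 + foldr _+_ 0ℚ (applyUpTo (g ∘ suc) n)
      ≡⟨ cong₂ _+_ (step 0) (sum-telescope n (G ∘ suc) (g ∘ suc) (step ∘ suc)) ⟩
    G 0 + - G 1 + (G 1 + - G (suc n))
      ≡⟨ cancel (G 0) (G 1) (G (suc n)) ⟩
    G 0 + - G (suc n) ∎
    where
    cancel : ∀ x y z → x + - y + (y + - z) ≡ x + - z
    cancel = solve-∀ ℚ-ring

  -- The bound `lo ≤ hi` matters: for `hi` < `lo` the sum is empty, while F lo - F hi can be
  -- nonzero.
  ∑-telescope : ∀ {lo hi} (F f : ℕ → ℚ) → (∀ k → f k ≡ F k + - F (suc k)) → lo ≤ hi →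
                ∑[ lo , hi ⟩ f ≡ F lo + - F hi
  ∑-telescope {lo} {hi} F f step lo≤hi = begin
    ∑[ lo , hi ⟩ f
      ≡⟨ sum-telescope (hi ∸ lo) (λ i → F (lo ℕ.+ i)) (λ i → f (lo ℕ.+ i)) shifted ⟩
    F (lo ℕ.+ 0) + - F (lo ℕ.+ (hi ∸ lo))
      ≡⟨ cong₂ (λ m n → F m + - F n) (ℕ.+-identityʳ lo) (ℕ.m+[n∸m]≡n lo≤hi) ⟩
    F lo + - F hi ∎
    where
    shifted : ∀ i → f (lo ℕ.+ i) ≡ F (lo ℕ.+ i) + - F (lo ℕ.+ suc i)
    shifted i = trans (step (lo ℕ.+ i)) (cong (λ m → F (lo ℕ.+ i) + - F m) (sym (ℕ.+-suc lo i)))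

  -- Arithmetic of coefficient lists, with its effect on values and on coefficients.

  infixl 6 _⊕₁_ _⊕_
  infixr 7 _⊙₁_ _⊙_ b⊛_ j⊛_

  _⊕₁_ : List ℚ → List ℚ → List ℚ
  []          ⊕₁ q       = q
  p@(_ ∷ _)   ⊕₁ []      = p
  (a ∷ p)     ⊕₁ (c ∷ q) = a + c ∷ p ⊕₁ q

  _⊕_ : Poly₂ → Poly₂ → Poly₂
  []          ⊕ Q       = Q
  P@(_ ∷ _)   ⊕ []      = P
  (p ∷ P)     ⊕ (q ∷ Q) = p ⊕₁ q ∷ P ⊕ Q

  _⊙₁_ : ℚ → List ℚ → List ℚ
  c ⊙₁ q = map (c *_) q

  _⊙_ : ℚ → Poly₂ → Poly₂
  c ⊙ Q = map (c ⊙₁_) Q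

  one : Poly₂
  one = (1ℚ ∷ []) ∷ []

  b⊛_ : Poly₂ → Poly₂
  b⊛ Q = [] ∷ Q

  j⊛_ : Poly₂ → Poly₂
  j⊛ Q = map (0ℚ ∷_) Q

  eval₁-⊕₁ : ∀ p q x → eval₁ (p ⊕₁ q) x ≡ eval₁ p x + eval₁ q x
  eval₁-⊕₁ []      q       x = sym (+-identityˡ (eval₁ q x))
  eval₁-⊕₁ (a ∷ p) []      x = sym (+-identityʳ (eval₁ (a ∷ p) x))
  eval₁-⊕₁ (a ∷ p) (c ∷ q) x = begin
    a + c + x * eval₁ (p ⊕₁ q) x             ≡⟨ cong (λ r → a + c + x * r) (eval₁-⊕₁ p q x) ⟩
    a + c + x * (eval₁ p x + eval₁ q x)      ≡⟨ regroup a c x (eval₁ p x) (eval₁ q x) ⟩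
    a + x * eval₁ p x + (c + x * eval₁ q x)  ∎
    where
    regroup : ∀ a c x u v → a + c + x * (u + v) ≡ a + x * u + (c + x * v)
    regroup = solve-∀ ℚ-ring

  eval₁-⊙₁ : ∀ c q x → eval₁ (c ⊙₁ q) x ≡ c * eval₁ q x
  eval₁-⊙₁ c []      x = sym (*-zeroʳ c)
  eval₁-⊙₁ c (a ∷ q) x = begin
    c * a + x * eval₁ (c ⊙₁ q) x  ≡⟨ cong (λ r → c * a + x * r) (eval₁-⊙₁ c q x) ⟩
    c * a + x * (c * eval₁ q x)   ≡⟨ regroup a c x (eval₁ q x) ⟩
    c * (a + x * eval₁ q x)       ∎
    where
    regroup : ∀ a c x u → c * a + x * (c * u) ≡ c * (a + x * u)
    regroup = solve-∀ ℚ-ring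

  eval-⊕ : ∀ P Q x y → (P ⊕ Q) ⟨ x , y ⟩ ≡ P ⟨ x , y ⟩ + Q ⟨ x , y ⟩
  eval-⊕ []      Q       x y = sym (+-identityˡ (Q ⟨ x , y ⟩))
  eval-⊕ (p ∷ P) []      x y = sym (+-identityʳ ((p ∷ P) ⟨ x , y ⟩))
  eval-⊕ (p ∷ P) (q ∷ Q) x y = begin
    eval₁ (p ⊕₁ q) y + x * (P ⊕ Q) ⟨ x , y ⟩
      ≡⟨ cong₂ (λ u v → u + x * v) (eval₁-⊕₁ p q y) (eval-⊕ P Q x y) ⟩
    eval₁ p y + eval₁ q y + x * (P ⟨ x , y ⟩ + Q ⟨ x , y ⟩)
      ≡⟨ regroup (eval₁ p y) (eval₁ q y) x (P ⟨ x , y ⟩) (Q ⟨ x , y ⟩) ⟩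
    eval₁ p y + x * P ⟨ x , y ⟩ + (eval₁ q y + x * Q ⟨ x , y ⟩) ∎
    where
    regroup : ∀ a c x u v → a + c + x * (u + v) ≡ a + x * u + (c + x * v)
    regroup = solve-∀ ℚ-ring

  eval-⊙ : ∀ c Q x y → (c ⊙ Q) ⟨ x , y ⟩ ≡ c * Q ⟨ x , y ⟩
  eval-⊙ c []      x y = sym (*-zeroʳ c)
  eval-⊙ c (q ∷ Q) x y = begin
    eval₁ (c ⊙₁ q) y + x * (c ⊙ Q) ⟨ x , y ⟩  ≡⟨ cong₂ (λ u v → u + x * v) (eval₁-⊙₁ c q y) (eval-⊙ c Q x y) ⟩
    c * eval₁ q y + x * (c * Q ⟨ x , y ⟩)     ≡⟨ regroup c (eval₁ q y) x (Q ⟨ x , y ⟩) ⟩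
    c * (eval₁ q y + x * Q ⟨ x , y ⟩)         ∎
    where
    regroup : ∀ c a x u → c * a + x * (c * u) ≡ c * (a + x * u)
    regroup = solve-∀ ℚ-ring

  eval-one : ∀ x y → one ⟨ x , y ⟩ ≡ 1ℚ
  eval-one = expand
    where
    expand : ∀ x y → 1ℚ + y * 0ℚ + x * 0ℚ ≡ 1ℚ
    expand = solve-∀ ℚ-ring

  eval-b⊛ : ∀ Q x y → (b⊛ Q) ⟨ x , y ⟩ ≡ x * Q ⟨ x , y ⟩
  eval-b⊛ Q x y = +-identityˡ (x * Q ⟨ x , y ⟩)

  eval-j⊛ : ∀ Q x y → (j⊛ Q) ⟨ x , y ⟩ ≡ y * Q ⟨ x , y ⟩
  eval-j⊛ []      x y = sym (*-zeroʳ y)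
  eval-j⊛ (q ∷ Q) x y = begin
    0ℚ + y * eval₁ q y + x * (j⊛ Q) ⟨ x , y ⟩   ≡⟨ cong (λ u → 0ℚ + y * eval₁ q y + x * u) (eval-j⊛ Q x y) ⟩
    0ℚ + y * eval₁ q y + x * (y * Q ⟨ x , y ⟩)  ≡⟨ regroup (eval₁ q y) x y (Q ⟨ x , y ⟩) ⟩
    y * (eval₁ q y + x * Q ⟨ x , y ⟩)           ∎
    where
    regroup : ∀ a x y u → 0ℚ + y * a + x * (y * u) ≡ y * (a + x * u)
    regroup = solve-∀ ℚ-ring

  -- The default is mapped together with the entries, which keeps the equation true past the end of
  -- the list. It is applied to maps sending the zero default to zero: scaling, and evaluation of
  -- the empty list.
  nth-map : ∀ {A B : Set} (f : A → B) d xs i → nth (f d) (map f xs) i ≡ f (nth d xs i)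
  nth-map f d []       i       = refl
  nth-map f d (x ∷ xs) zero    = refl
  nth-map f d (x ∷ xs) (suc i) = nth-map f d xs i

  nth-⊕₁ : ∀ p q k → nth 0ℚ (p ⊕₁ q) k ≡ nth 0ℚ p k + nth 0ℚ q k
  nth-⊕₁ []      q       k       = sym (+-identityˡ (nth 0ℚ q k))
  nth-⊕₁ (a ∷ p) []      k       = sym (+-identityʳ (nth 0ℚ (a ∷ p) k))
  nth-⊕₁ (a ∷ p) (c ∷ q) zero    = refl
  nth-⊕₁ (a ∷ p) (c ∷ q) (suc k) = nth-⊕₁ p q k

  nth-⊙₁ : ∀ c q k → nth 0ℚ (c ⊙₁ q) k ≡ c * nth 0ℚ q k
  nth-⊙₁ c q k = subst (λ d → nth d (c ⊙₁ q) k ≡ c * nth 0ℚ q k) (*-zeroʳ c) (nth-map (c *_) 0ℚ q k)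

  coeff-⊕ : ∀ P Q i k → coeff (P ⊕ Q) i k ≡ coeff P i k + coeff Q i k
  coeff-⊕ []      Q       i       k = sym (+-identityˡ (coeff Q i k))
  coeff-⊕ (p ∷ P) []      i       k = sym (+-identityʳ (coeff (p ∷ P) i k))
  coeff-⊕ (p ∷ P) (q ∷ Q) zero    k = nth-⊕₁ p q k
  coeff-⊕ (p ∷ P) (q ∷ Q) (suc i) k = coeff-⊕ P Q i k

  coeff-⊙ : ∀ c Q i k → coeff (c ⊙ Q) i k ≡ c * coeff Q i k
  coeff-⊙ c Q i k = trans (cong (λ q → nth 0ℚ q k) (nth-map (c ⊙₁_) [] Q i)) (nth-⊙₁ c (nth [] Q i) k)

  coeff-j⊛-zero : ∀ Q i → coeff (j⊛ Q) i 0 ≡ 0ℚ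
  coeff-j⊛-zero []      i       = refl
  coeff-j⊛-zero (q ∷ Q) zero    = refl
  coeff-j⊛-zero (q ∷ Q) (suc i) = coeff-j⊛-zero Q i

  coeff-j⊛-suc : ∀ Q i k → coeff (j⊛ Q) i (suc k) ≡ coeff Q i k
  coeff-j⊛-suc []      i       k = refl
  coeff-j⊛-suc (q ∷ Q) zero    k = refl
  coeff-j⊛-suc (q ∷ Q) (suc i) k = coeff-j⊛-suc Q i k

  -- A polynomial is determined by its values at infinitely many points.

  -- Synthetic division by x − r: the coefficients of the quotient are the values
  -- at r of the successive tails.
  quotient : ℚ → List ℚ → List ℚ
  quotient r []            = []
  quotient r (a ∷ [])      = []
  quotient r (a ∷ q@(_ ∷ _)) = eval₁ q r ∷ quotient r q

  length-quotient : ∀ r q → length (quotient r q) ≡ ℕ.pred (length q)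
  length-quotient r []          = refl
  length-quotient r (a ∷ [])    = refl
  length-quotient r (a ∷ c ∷ q) = cong suc (length-quotient r (c ∷ q))

  -- Division with remainder, the remainder being the value at `r`. Hence if `r` is a root of `q`,
  -- every other root of `q` is a root of the quotient.
  eval₁-quotient : ∀ r q x → eval₁ q x ≡ eval₁ q r + (x + - r) * eval₁ (quotient r q) x
  eval₁-quotient r [] x = sym (trans (+-identityˡ _) (*-zeroʳ (x + - r)))
  eval₁-quotient r (a ∷ []) x = expand a r x
    where
    expand : ∀ a r x → a + x * 0ℚ ≡ a + r * 0ℚ + (x + - r) * 0ℚ
    expand = solve-∀ ℚ-ring
  eval₁-quotient r (a ∷ q@(_ ∷ _)) x = begin
    a + x * eval₁ q x                    ≡⟨ cong (λ u → a + x * u) (eval₁-quotient r q x) ⟩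
    a + x * (v + (x + - r) * s)          ≡⟨ regroup a r x v s ⟩
    a + r * v + (x + - r) * (v + x * s)  ∎
    where
    v = eval₁ q r
    s = eval₁ (quotient r q) x
    regroup : ∀ a r x v s → a + x * (v + (x + - r) * s) ≡ a + r * v + (x + - r) * (v + x * s)
    regroup = solve-∀ ℚ-ring

  Vanishes : List ℚ → Set
  Vanishes q = ∀ k → nth 0ℚ q k ≡ 0ℚ

  -- The head of the quotient is the value of the tail of `q` at `r`. When it is zero, the value of
  -- `q` at `r` is just its constant coefficient, and the tail has `r` as a root, so the argument
  -- repeats on the tail.
  quotient-vanishes : ∀ r q → eval₁ q r ≡ 0ℚ → Vanishes (quotient r q) → Vanishes q
  quotient-vanishes r [] _ _ k = refl
  quotient-vanishes r (a ∷ []) root _ zero = begin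
    a           ≡⟨ +-identityʳ a ⟨
    a + 0ℚ      ≡⟨ cong (a +_) (*-zeroʳ r) ⟨
    a + r * 0ℚ  ≡⟨ root ⟩
    0ℚ          ∎
  quotient-vanishes r (a ∷ []) root _ (suc k) = refl
  quotient-vanishes r (a ∷ q@(_ ∷ _)) root van zero = begin
    a                  ≡⟨ +-identityʳ a ⟨
    a + 0ℚ             ≡⟨ cong (a +_) (*-zeroʳ r) ⟨
    a + r * 0ℚ         ≡⟨ cong (λ u → a + r * u) (van 0) ⟨
    a + r * eval₁ q r  ≡⟨ root ⟩
    0ℚ                 ∎
  quotient-vanishes r (a ∷ q@(_ ∷ _)) root van (suc k) = quotient-vanishes r q (van 0) (van ∘ suc) k

  -- Divide out the root `x 0` and continue with the sequence shifted by one; injectivity makes its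
  -- points differ from `x 0`, so they are roots of the quotient. The recursion is on the length
  -- bound `n`, because the quotient is not a structural subterm of `q`.
  infinitely-many-roots : ∀ n q → length q ≤ n → (x : ℕ → ℚ) → Injective _≡_ _≡_ x →
                          (∀ i → eval₁ q (x i) ≡ 0ℚ) → Vanishes q
  infinitely-many-roots n       []      _   x x-inj roots k = refl
  infinitely-many-roots (suc n) q@(_ ∷ _) len x x-inj roots =
    quotient-vanishes r q (roots 0)
      (infinitely-many-roots n (quotient r q)
        (subst (_≤ n) (sym (length-quotient r q)) (ℕ.pred-mono-≤ len))
        (x ∘ suc) (ℕ.suc-injective ∘ x-inj) quotient-roots)
    where
    r = x 0
    quotient-roots : ∀ i → eval₁ (quotient r q) (x (suc i)) ≡ 0ℚ
    quotient-roots i = *-cancelˡ-≢0 (x (suc i) + - r)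
      (λ eq → ℕ.1+n≢0 (x-inj (x-y≡0⇒x≡y _ _ eq)))
      (begin
        (x (suc i) + - r) * s              ≡⟨ +-identityˡ _ ⟨
        0ℚ + (x (suc i) + - r) * s         ≡⟨ cong (_+ (x (suc i) + - r) * s) (roots 0) ⟨
        eval₁ q r + (x (suc i) + - r) * s  ≡⟨ eval₁-quotient r q (x (suc i)) ⟨
        eval₁ q (x (suc i))                ≡⟨ roots (suc i) ⟩
        0ℚ                                 ≡⟨ *-zeroʳ (x (suc i) + - r) ⟨
        (x (suc i) + - r) * 0ℚ             ∎)
      where s = eval₁ (quotient r q) (x (suc i))

  eval₁-injective : ∀ p q (x : ℕ → ℚ) → Injective _≡_ _≡_ x →
                    (∀ i → eval₁ p (x i) ≡ eval₁ q (x i)) → ∀ k → nth 0ℚ p k ≡ nth 0ℚ q k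
  eval₁-injective p q x x-inj agree k = x-y≡0⇒x≡y _ _ (begin
    nth 0ℚ p k + - nth 0ℚ q k
      ≡⟨ cong (nth 0ℚ p k +_) (negate (nth 0ℚ q k)) ⟩
    nth 0ℚ p k + - 1ℚ * nth 0ℚ q k
      ≡⟨ cong (nth 0ℚ p k +_) (nth-⊙₁ (- 1ℚ) q k) ⟨
    nth 0ℚ p k + nth 0ℚ (- 1ℚ ⊙₁ q) k
      ≡⟨ nth-⊕₁ p (- 1ℚ ⊙₁ q) k ⟨
    nth 0ℚ (p ⊕₁ - 1ℚ ⊙₁ q) k
      ≡⟨ infinitely-many-roots _ (p ⊕₁ - 1ℚ ⊙₁ q) ℕ.≤-refl x x-inj difference-root k ⟩
    0ℚ ∎)
    where
    negate : ∀ a → - a ≡ - 1ℚ * a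
    negate = solve-∀ ℚ-ring
    difference-root : ∀ i → eval₁ (p ⊕₁ - 1ℚ ⊙₁ q) (x i) ≡ 0ℚ
    difference-root i = begin
      eval₁ (p ⊕₁ - 1ℚ ⊙₁ q) (x i)             ≡⟨ eval₁-⊕₁ p (- 1ℚ ⊙₁ q) (x i) ⟩
      eval₁ p (x i) + eval₁ (- 1ℚ ⊙₁ q) (x i)  ≡⟨ cong₂ _+_ (agree i) (eval₁-⊙₁ (- 1ℚ) q (x i)) ⟩
      eval₁ q (x i) + - 1ℚ * eval₁ q (x i)     ≡⟨ cong (eval₁ q (x i) +_) (negate (eval₁ q (x i))) ⟨
      eval₁ q (x i) + - eval₁ q (x i)          ≡⟨ +-inverseʳ (eval₁ q (x i)) ⟩
      0ℚ                                       ∎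

  -- Points with y = −m and x > m are those at which the second identity
  -- determines the value of the polynomial.
  eval-injective : ∀ P Q →
    (∀ m n → P ⟨ fromℕ (suc m ℕ.+ n) , - fromℕ m ⟩ ≡ Q ⟨ fromℕ (suc m ℕ.+ n) , - fromℕ m ⟩) → P ≈ Q
  eval-injective P Q agree i = eval₁-injective (nth [] P i) (nth [] Q i) (λ m → - fromℕ m)
    (fromℕ-injective ∘ neg-injective)
    -- Two stages: for fixed m the specialisations to j = -m agree at all b > m, hence have equal
    -- coefficients in b. These are the values at -m of the coefficient polynomials in j, and
    -- letting m vary identifies the latter.
    (λ m → let ev = λ q → eval₁ q (- fromℕ m) in begin
      ev (nth [] P i)      ≡⟨ nth-map ev [] P i ⟨
      nth 0ℚ (map ev P) i  ≡⟨ eval₁-injective (map ev P) (map ev Q) (λ n → fromℕ (suc m ℕ.+ n))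
                                 (ℕ.+-cancelˡ-≡ (suc m) _ _ ∘ fromℕ-injective) (agree m) i ⟩
      nth 0ℚ (map ev Q) i  ≡⟨ nth-map ev [] Q i ⟩
      ev (nth [] Q i)      ∎)

  eval₁-vanishing : ∀ q → Vanishes q → ∀ x → eval₁ q x ≡ 0ℚ
  eval₁-vanishing []      van x = refl
  eval₁-vanishing (a ∷ q) van x = begin
    a + x * eval₁ q x  ≡⟨ cong₂ (λ u v → u + x * v) (van 0) (eval₁-vanishing q (van ∘ suc) x) ⟩
    0ℚ + x * 0ℚ        ≡⟨ +-identityˡ (x * 0ℚ) ⟩
    x * 0ℚ             ≡⟨ *-zeroʳ x ⟩
    0ℚ                 ∎

  eval₁-cong : ∀ p q → (∀ k → nth 0ℚ p k ≡ nth 0ℚ q k) → ∀ x → eval₁ p x ≡ eval₁ q x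
  eval₁-cong []      q       eq x = sym (eval₁-vanishing q (sym ∘ eq) x)
  eval₁-cong (a ∷ p) []      eq x = eval₁-vanishing (a ∷ p) eq x
  eval₁-cong (a ∷ p) (c ∷ q) eq x = cong₂ (λ u v → u + x * v) (eq 0) (eval₁-cong p q (eq ∘ suc) x)

  -- Lists related by `≈` may differ in trailing zeros, so evaluation has to be shown to respect it;
  -- an excess tail consists of zeros and evaluates to zero.
  eval-cong : ∀ P Q → P ≈ Q → ∀ x y → P ⟨ x , y ⟩ ≡ Q ⟨ x , y ⟩
  eval-cong P Q P≈Q x y = eval₁-cong (map ev P) (map ev Q) (λ i → begin
    nth 0ℚ (map ev P) i  ≡⟨ nth-map ev [] P i ⟩
    ev (nth [] P i)      ≡⟨ eval₁-cong (nth [] P i) (nth [] Q i) (P≈Q i) y ⟩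
    ev (nth [] Q i)      ≡⟨ nth-map ev [] Q i ⟨
    nth 0ℚ (map ev Q) i  ∎) x
    where
    ev : List ℚ → ℚ
    ev q = eval₁ q y

  -- The operator `gosper` and the solution of its equation.

  -- With Q = (b + j) P, the product t(b) Q(b, j) telescopes to weight · t exactly when
  -- gosper P is the weight, for both hypergeometric terms t of the theorem.
  gosper : Poly₂ → ℚ → ℚ → ℚ
  gosper P x y = (x + y) * P ⟨ x , y ⟩ + (x + 1ℚ + - y) * P ⟨ x + 1ℚ , y ⟩

  -- The factor is (x - i)(x + i + 1) multiplied out.
  shiftProduct : ℕ → ℚ → ℚ
  shiftProduct zero    x = 1ℚ
  shiftProduct (suc i) x = shiftProduct i x * (x * x + x + - (fromℕ i * (fromℕ i + 1ℚ)))

  weightProduct : ℕ → ℚ → ℚ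
  weightProduct zero    x = 1ℚ
  weightProduct (suc n) x = weightProduct n x * ((x + x + 1ℚ) * (x + x + 1ℚ) + - (fromℕ (suc n) * fromℕ (suc n)))

  evenProduct : ℕ → Poly₂
  evenProduct zero    = one
  evenProduct (suc i) = (b⊛ b⊛ evenProduct i) ⊕ (- (fromℕ i * fromℕ i)) ⊙ evenProduct i

  basicSolution : ℕ → Poly₂
  basicSolution zero    = one
  basicSolution (suc i) = evenProduct (suc i) ⊕ fromℕ (suc i) ⊙ ((j⊛ basicSolution i) ⊕ (- fromℕ (suc i)) ⊙ basicSolution i)

  -- (2x+1)² − (n+1)² = 4 (x − i)(x + i + 1) + mixing i n.
  mixing : ℕ → ℕ → ℚ
  mixing i n = (fromℕ i + fromℕ i + 1ℚ) * (fromℕ i + fromℕ i + 1ℚ) + - (fromℕ (suc n) * fromℕ (suc n))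

  -- Solves the equation with right-hand side (2x+1) times `shiftProduct i` times `weightProduct n`.
  -- Splitting the last factor of the weight by `mixing` trades it for a further factor of
  -- `shiftProduct` plus a constant, so the weight is expanded without explicit coefficients.
  solution : ℕ → ℕ → Poly₂
  solution i zero    = basicSolution i
  solution i (suc n) = fromℕ 4 ⊙ solution (suc i) n ⊕ mixing i n ⊙ solution i n

  eval-evenProduct-suc : ∀ i x y → evenProduct (suc i) ⟨ x , y ⟩ ≡ (x * x + - (fromℕ i * fromℕ i)) * evenProduct i ⟨ x , y ⟩
  eval-evenProduct-suc i x y = begin
    evenProduct (suc i) ⟨ x , y ⟩            ≡⟨ eval-⊕ (b⊛ b⊛ E) (c ⊙ E) x y ⟩
    (b⊛ b⊛ E) ⟨ x , y ⟩ + (c ⊙ E) ⟨ x , y ⟩  ≡⟨ cong₂ _+_ (eval-b⊛ (b⊛ E) x y) (eval-⊙ c E x y) ⟩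
    x * (b⊛ E) ⟨ x , y ⟩ + c * E ⟨ x , y ⟩   ≡⟨ cong (λ u → x * u + c * E ⟨ x , y ⟩) (eval-b⊛ E x y) ⟩
    x * (x * E ⟨ x , y ⟩) + c * E ⟨ x , y ⟩  ≡⟨ regroup x c (E ⟨ x , y ⟩) ⟩
    (x * x + c) * E ⟨ x , y ⟩                ∎
    where
    E = evenProduct i
    c = - (fromℕ i * fromℕ i)
    regroup : ∀ x c u → x * (x * u) + c * u ≡ (x * x + c) * u
    regroup = solve-∀ ℚ-ring

  -- The linear factors are x - l and x + l for 0 ≤ l ≤ i. Setting aside x - i and x + 0 leaves
  -- exactly those of `shiftProduct i`.
  evenProduct-factor : ∀ i x y → evenProduct (suc i) ⟨ x , y ⟩ ≡ x * (x + - fromℕ i) * shiftProduct i x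
  evenProduct-factor zero x y = begin
    evenProduct 1 ⟨ x , y ⟩                ≡⟨ eval-evenProduct-suc 0 x y ⟩
    (x * x + - (0ℚ * 0ℚ)) * one ⟨ x , y ⟩  ≡⟨ cong ((x * x + - (0ℚ * 0ℚ)) *_) (eval-one x y) ⟩
    (x * x + - (0ℚ * 0ℚ)) * 1ℚ             ≡⟨ regroup x ⟩
    x * (x + - 0ℚ) * 1ℚ                    ∎
    where
    regroup : ∀ x → (x * x + - (0ℚ * 0ℚ)) * 1ℚ ≡ x * (x + - 0ℚ) * 1ℚ
    regroup = solve-∀ ℚ-ring
  evenProduct-factor (suc i) x y = begin
    evenProduct (suc (suc i)) ⟨ x , y ⟩
      ≡⟨ eval-evenProduct-suc (suc i) x y ⟩
    (x * x + - (fromℕ (suc i) * fromℕ (suc i))) * evenProduct (suc i) ⟨ x , y ⟩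
      ≡⟨ cong₂ (λ u v → (x * x + - (u * u)) * v) (fromℕ-suc i) (evenProduct-factor i x y) ⟩
    (x * x + - ((ι + 1ℚ) * (ι + 1ℚ))) * (x * (x + - ι) * shiftProduct i x)
      ≡⟨ regroup x ι (shiftProduct i x) ⟩
    x * (x + - (ι + 1ℚ)) * shiftProduct (suc i) x
      ≡⟨ cong (λ u → x * (x + - u) * shiftProduct (suc i) x) (fromℕ-suc i) ⟨
    x * (x + - fromℕ (suc i)) * shiftProduct (suc i) x ∎
    where
    ι = fromℕ i
    regroup : ∀ x ι v → (x * x + - ((ι + 1ℚ) * (ι + 1ℚ))) * (x * (x + - ι) * v)
                      ≡ x * (x + - (ι + 1ℚ)) * (v * (x * x + x + - (ι * (ι + 1ℚ))))
    regroup = solve-∀ ℚ-ring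

  -- After the shift the factors are x + 1 - l and x + 1 + l for 0 ≤ l ≤ i. Setting aside x + 1 and
  -- x + 1 + i again leaves `shiftProduct i`, so both values entering `gosper` share this factor.
  evenProduct-factor-shift : ∀ i x y → evenProduct (suc i) ⟨ x + 1ℚ , y ⟩ ≡ (x + 1ℚ) * (x + fromℕ i + 1ℚ) * shiftProduct i x
  evenProduct-factor-shift zero x y = trans (evenProduct-factor 0 (x + 1ℚ) y) (regroup x)
    where
    regroup : ∀ x → (x + 1ℚ) * (x + 1ℚ + - 0ℚ) * 1ℚ ≡ (x + 1ℚ) * (x + 0ℚ + 1ℚ) * 1ℚ
    regroup = solve-∀ ℚ-ring
  evenProduct-factor-shift (suc i) x y = begin
    evenProduct (suc (suc i)) ⟨ x + 1ℚ , y ⟩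
      ≡⟨ eval-evenProduct-suc (suc i) (x + 1ℚ) y ⟩
    ((x + 1ℚ) * (x + 1ℚ) + - (fromℕ (suc i) * fromℕ (suc i))) * evenProduct (suc i) ⟨ x + 1ℚ , y ⟩
      ≡⟨ cong₂ (λ u v → ((x + 1ℚ) * (x + 1ℚ) + - (u * u)) * v) (fromℕ-suc i) (evenProduct-factor-shift i x y) ⟩
    ((x + 1ℚ) * (x + 1ℚ) + - ((ι + 1ℚ) * (ι + 1ℚ))) * ((x + 1ℚ) * (x + ι + 1ℚ) * shiftProduct i x)
      ≡⟨ regroup x ι (shiftProduct i x) ⟩
    (x + 1ℚ) * (x + (ι + 1ℚ) + 1ℚ) * shiftProduct (suc i) x
      ≡⟨ cong (λ u → (x + 1ℚ) * (x + u + 1ℚ) * shiftProduct (suc i) x) (fromℕ-suc i) ⟨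
    (x + 1ℚ) * (x + fromℕ (suc i) + 1ℚ) * shiftProduct (suc i) x ∎
    where
    ι = fromℕ i
    regroup : ∀ x ι v → ((x + 1ℚ) * (x + 1ℚ) + - ((ι + 1ℚ) * (ι + 1ℚ))) * ((x + 1ℚ) * (x + ι + 1ℚ) * v)
                      ≡ (x + 1ℚ) * (x + (ι + 1ℚ) + 1ℚ) * (v * (x * x + x + - (ι * (ι + 1ℚ))))
    regroup = solve-∀ ℚ-ring

  -- With `shiftProduct i` taken out, a cubic identity in x remains. The second summand is the
  -- lower-order term that the recursive part of `basicSolution` cancels.
  gosper-evenProduct : ∀ i x y → gosper (evenProduct (suc i)) x y
                  ≡ (x + x + 1ℚ) * (shiftProduct (suc i) x + fromℕ (suc i) * (fromℕ (suc i) + - y) * shiftProduct i x)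
  gosper-evenProduct i x y = begin
    gosper (evenProduct (suc i)) x y
      ≡⟨ cong₂ (λ u v → (x + y) * u + (x + 1ℚ + - y) * v) (evenProduct-factor i x y) (evenProduct-factor-shift i x y) ⟩
    (x + y) * (x * (x + - ι) * shiftProduct i x) + (x + 1ℚ + - y) * ((x + 1ℚ) * (x + ι + 1ℚ) * shiftProduct i x)
      ≡⟨ regroup x y ι (shiftProduct i x) ⟩
    (x + x + 1ℚ) * (shiftProduct (suc i) x + (ι + 1ℚ) * (ι + 1ℚ + - y) * shiftProduct i x)
      ≡⟨ cong (λ u → (x + x + 1ℚ) * (shiftProduct (suc i) x + u * (u + - y) * shiftProduct i x)) (fromℕ-suc i) ⟨
    (x + x + 1ℚ) * (shiftProduct (suc i) x + fromℕ (suc i) * (fromℕ (suc i) + - y) * shiftProduct i x) ∎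
    where
    ι = fromℕ i
    regroup : ∀ x y ι v → (x + y) * (x * (x + - ι) * v) + (x + 1ℚ + - y) * ((x + 1ℚ) * (x + ι + 1ℚ) * v)
            ≡ (x + x + 1ℚ) * (v * (x * x + x + - (ι * (ι + 1ℚ))) + (ι + 1ℚ) * (ι + 1ℚ + - y) * v)
    regroup = solve-∀ ℚ-ring

  eval-basicSolution-suc : ∀ i x y → basicSolution (suc i) ⟨ x , y ⟩
             ≡ evenProduct (suc i) ⟨ x , y ⟩ + fromℕ (suc i) * ((y + - fromℕ (suc i)) * basicSolution i ⟨ x , y ⟩)
  eval-basicSolution-suc i x y = begin
    basicSolution (suc i) ⟨ x , y ⟩
      ≡⟨ eval-⊕ E (s ⊙ ((j⊛ basicSolution i) ⊕ (- s) ⊙ basicSolution i)) x y ⟩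
    E ⟨ x , y ⟩ + (s ⊙ ((j⊛ basicSolution i) ⊕ (- s) ⊙ basicSolution i)) ⟨ x , y ⟩
      ≡⟨ cong (E ⟨ x , y ⟩ +_) (eval-⊙ s ((j⊛ basicSolution i) ⊕ (- s) ⊙ basicSolution i) x y) ⟩
    E ⟨ x , y ⟩ + s * ((j⊛ basicSolution i) ⊕ (- s) ⊙ basicSolution i) ⟨ x , y ⟩
      ≡⟨ cong (λ u → E ⟨ x , y ⟩ + s * u) inner ⟩
    E ⟨ x , y ⟩ + s * ((y + - s) * basicSolution i ⟨ x , y ⟩) ∎
    where
    E = evenProduct (suc i)
    s = fromℕ (suc i)
    inner : ((j⊛ basicSolution i) ⊕ (- s) ⊙ basicSolution i) ⟨ x , y ⟩ ≡ (y + - s) * basicSolution i ⟨ x , y ⟩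
    inner = begin
      ((j⊛ basicSolution i) ⊕ (- s) ⊙ basicSolution i) ⟨ x , y ⟩
        ≡⟨ eval-⊕ (j⊛ basicSolution i) ((- s) ⊙ basicSolution i) x y ⟩
      (j⊛ basicSolution i) ⟨ x , y ⟩ + ((- s) ⊙ basicSolution i) ⟨ x , y ⟩
        ≡⟨ cong₂ _+_ (eval-j⊛ (basicSolution i) x y) (eval-⊙ (- s) (basicSolution i) x y) ⟩
      y * basicSolution i ⟨ x , y ⟩ + - s * basicSolution i ⟨ x , y ⟩
        ≡⟨ *-distribʳ-+ (basicSolution i ⟨ x , y ⟩) y (- s) ⟨
      (y + - s) * basicSolution i ⟨ x , y ⟩ ∎

  -- The multiplier s (y - s) is free of x, so it passes through `gosper`. By induction the
  -- correction then contributes the opposite of the lower-order term in `gosper-evenProduct`.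
  gosper-basicSolution : ∀ i x y → gosper (basicSolution i) x y ≡ (x + x + 1ℚ) * shiftProduct i x
  gosper-basicSolution zero x y = trans
    (cong₂ (λ u v → (x + y) * u + (x + 1ℚ + - y) * v) (eval-one x y) (eval-one (x + 1ℚ) y))
    (regroup x y)
    where
    regroup : ∀ x y → (x + y) * 1ℚ + (x + 1ℚ + - y) * 1ℚ ≡ (x + x + 1ℚ) * 1ℚ
    regroup = solve-∀ ℚ-ring
  gosper-basicSolution (suc i) x y = begin
    gosper (basicSolution (suc i)) x y
      ≡⟨ cong₂ (λ u v → (x + y) * u + (x + 1ℚ + - y) * v) (eval-basicSolution-suc i x y) (eval-basicSolution-suc i (x + 1ℚ) y) ⟩
    (x + y) * (E₀ + s * ((y + - s) * R₀)) + (x + 1ℚ + - y) * (E₁ + s * ((y + - s) * R₁))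
      ≡⟨ split x y s E₀ E₁ R₀ R₁ ⟩
    gosper (evenProduct (suc i)) x y + s * (y + - s) * gosper (basicSolution i) x y
      ≡⟨ cong₂ (λ u v → u + s * (y + - s) * v) (gosper-evenProduct i x y) (gosper-basicSolution i x y) ⟩
    (x + x + 1ℚ) * (shiftProduct (suc i) x + s * (s + - y) * shiftProduct i x) + s * (y + - s) * ((x + x + 1ℚ) * shiftProduct i x)
      ≡⟨ cancel x y s (shiftProduct (suc i) x) (shiftProduct i x) ⟩
    (x + x + 1ℚ) * shiftProduct (suc i) x ∎
    where
    s = fromℕ (suc i)
    E₀ = evenProduct (suc i) ⟨ x , y ⟩
    E₁ = evenProduct (suc i) ⟨ x + 1ℚ , y ⟩
    R₀ = basicSolution i ⟨ x , y ⟩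
    R₁ = basicSolution i ⟨ x + 1ℚ , y ⟩
    split : ∀ x y s e₀ e₁ r₀ r₁ →
      (x + y) * (e₀ + s * ((y + - s) * r₀)) + (x + 1ℚ + - y) * (e₁ + s * ((y + - s) * r₁))
      ≡ ((x + y) * e₀ + (x + 1ℚ + - y) * e₁) + s * (y + - s) * ((x + y) * r₀ + (x + 1ℚ + - y) * r₁)
    split = solve-∀ ℚ-ring
    cancel : ∀ x y s u v →
      (x + x + 1ℚ) * (u + s * (s + - y) * v) + s * (y + - s) * ((x + x + 1ℚ) * v) ≡ (x + x + 1ℚ) * u
    cancel = solve-∀ ℚ-ring

  gosper-⊕ : ∀ P Q x y → gosper (P ⊕ Q) x y ≡ gosper P x y + gosper Q x y
  gosper-⊕ P Q x y = trans
    (cong₂ (λ u v → (x + y) * u + (x + 1ℚ + - y) * v) (eval-⊕ P Q x y) (eval-⊕ P Q (x + 1ℚ) y))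
    (regroup x y (P ⟨ x , y ⟩) (P ⟨ x + 1ℚ , y ⟩) (Q ⟨ x , y ⟩) (Q ⟨ x + 1ℚ , y ⟩))
    where
    regroup : ∀ x y p₀ p₁ q₀ q₁ →
      (x + y) * (p₀ + q₀) + (x + 1ℚ + - y) * (p₁ + q₁)
      ≡ ((x + y) * p₀ + (x + 1ℚ + - y) * p₁) + ((x + y) * q₀ + (x + 1ℚ + - y) * q₁)
    regroup = solve-∀ ℚ-ring

  gosper-⊙ : ∀ c P x y → gosper (c ⊙ P) x y ≡ c * gosper P x y
  gosper-⊙ c P x y = trans
    (cong₂ (λ u v → (x + y) * u + (x + 1ℚ + - y) * v) (eval-⊙ c P x y) (eval-⊙ c P (x + 1ℚ) y))
    (regroup x y c (P ⟨ x , y ⟩) (P ⟨ x + 1ℚ , y ⟩))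
    where
    regroup : ∀ x y c p₀ p₁ →
      (x + y) * (c * p₀) + (x + 1ℚ + - y) * (c * p₁) ≡ c * ((x + y) * p₀ + (x + 1ℚ + - y) * p₁)
    regroup = solve-∀ ℚ-ring

  gosper-solution : ∀ i n x y → gosper (solution i n) x y ≡ (x + x + 1ℚ) * (shiftProduct i x * weightProduct n x)
  gosper-solution i zero    x y = trans (gosper-basicSolution i x y) (cong ((x + x + 1ℚ) *_) (sym (*-identityʳ (shiftProduct i x))))
  gosper-solution i (suc n) x y = begin
    gosper (solution i (suc n)) x y
      ≡⟨ gosper-⊕ (fromℕ 4 ⊙ solution (suc i) n) (c ⊙ solution i n) x y ⟩
    gosper (fromℕ 4 ⊙ solution (suc i) n) x y + gosper (c ⊙ solution i n) x y
      ≡⟨ cong₂ _+_ (gosper-⊙ (fromℕ 4) (solution (suc i) n) x y) (gosper-⊙ c (solution i n) x y) ⟩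
    fromℕ 4 * gosper (solution (suc i) n) x y + c * gosper (solution i n) x y
      ≡⟨ cong₂ (λ u v → fromℕ 4 * u + c * v) (gosper-solution (suc i) n x y) (gosper-solution i n x y) ⟩
    fromℕ 4 * ((x + x + 1ℚ) * (shiftProduct (suc i) x * weightProduct n x)) + c * ((x + x + 1ℚ) * (shiftProduct i x * weightProduct n x))
      ≡⟨ regroup x (fromℕ i) (fromℕ (suc n)) (shiftProduct i x) (weightProduct n x) ⟩
    (x + x + 1ℚ) * (shiftProduct i x * weightProduct (suc n) x) ∎
    where
    c = mixing i n
    regroup : ∀ x ι ν u v →
      -- This sum equals `fromℕ 4` by computation and is written in ring operations for the solver.
      (1ℚ + 1ℚ + 1ℚ + 1ℚ) * ((x + x + 1ℚ) * (u * (x * x + x + - (ι * (ι + 1ℚ))) * v))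
        + ((ι + ι + 1ℚ) * (ι + ι + 1ℚ) + - (ν * ν)) * ((x + x + 1ℚ) * (u * v))
      ≡ (x + x + 1ℚ) * (u * (v * ((x + x + 1ℚ) * (x + x + 1ℚ) + - (ν * ν))))
    regroup = solve-∀ ℚ-ring

  -- Degree bounds and leading coefficients.

  VanishesAboveInB VanishesAboveInJ : ℕ → Poly₂ → Set
  VanishesAboveInB d P = ∀ i k → d < i → coeff P i k ≡ 0ℚ
  VanishesAboveInJ d P = ∀ i k → d < k → coeff P i k ≡ 0ℚ

  coeff-⊕-0 : ∀ P Q i k → coeff P i k ≡ 0ℚ → coeff Q i k ≡ 0ℚ → coeff (P ⊕ Q) i k ≡ 0ℚ
  coeff-⊕-0 P Q i k p q = trans (coeff-⊕ P Q i k) (cong₂ _+_ p q)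

  coeff-⊙-0 : ∀ c Q i k → coeff Q i k ≡ 0ℚ → coeff (c ⊙ Q) i k ≡ 0ℚ
  coeff-⊙-0 c Q i k q = trans (coeff-⊙ c Q i k) (trans (cong (c *_) q) (*-zeroʳ c))

  b⊛-vanishesInB : ∀ {d} P → VanishesAboveInB d P → VanishesAboveInB (suc d) (b⊛ P)
  b⊛-vanishesInB P van (suc i) k (s≤s d<i) = van i k d<i

  b⊛-vanishesInJ : ∀ {d} P → VanishesAboveInJ d P → VanishesAboveInJ d (b⊛ P)
  b⊛-vanishesInJ P van zero    k d<k = refl
  b⊛-vanishesInJ P van (suc i) k d<k = van i k d<k

  j⊛-vanishesInB : ∀ {d} P → VanishesAboveInB d P → VanishesAboveInB d (j⊛ P)
  j⊛-vanishesInB P van i zero    d<i = coeff-j⊛-zero P i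
  j⊛-vanishesInB P van i (suc k) d<i = trans (coeff-j⊛-suc P i k) (van i k d<i)

  j⊛-vanishesInJ : ∀ {d} P → VanishesAboveInJ d P → VanishesAboveInJ (suc d) (j⊛ P)
  j⊛-vanishesInJ P van i (suc k) (s≤s d<k) = trans (coeff-j⊛-suc P i k) (van i k d<k)

  one-vanishesInB : VanishesAboveInB 0 one
  one-vanishesInB (suc i) k _ = refl

  one-vanishesInJ : VanishesAboveInJ 0 one
  one-vanishesInJ zero    (suc k) _ = refl
  one-vanishesInJ (suc i) (suc k) _ = refl

  -- The order of the factors in `i ℕ.* 2` makes the bound at a successor reduce to two more than
  -- the previous one, matching the two applications of `b⊛_`.
  evenProduct-vanishesInB : ∀ i → VanishesAboveInB (i ℕ.* 2) (evenProduct i)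
  evenProduct-vanishesInB zero    = one-vanishesInB
  evenProduct-vanishesInB (suc i) m k lt =
    coeff-⊕-0 (b⊛ b⊛ evenProduct i) ((- (fromℕ i * fromℕ i)) ⊙ evenProduct i) m k
      (b⊛-vanishesInB (b⊛ evenProduct i) (b⊛-vanishesInB (evenProduct i) (evenProduct-vanishesInB i)) m k lt)
      (coeff-⊙-0 (- (fromℕ i * fromℕ i)) (evenProduct i) m k
        (evenProduct-vanishesInB i m k (ℕ.<-trans (ℕ.m<n+m (i ℕ.* 2) (s≤s z≤n)) lt)))

  evenProduct-vanishesInJ : ∀ i → VanishesAboveInJ 0 (evenProduct i)
  evenProduct-vanishesInJ zero    = one-vanishesInJ
  evenProduct-vanishesInJ (suc i) m k lt =
    coeff-⊕-0 (b⊛ b⊛ evenProduct i) ((- (fromℕ i * fromℕ i)) ⊙ evenProduct i) m k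
      (b⊛-vanishesInJ (b⊛ evenProduct i) (b⊛-vanishesInJ (evenProduct i) (evenProduct-vanishesInJ i)) m k lt)
      (coeff-⊙-0 (- (fromℕ i * fromℕ i)) (evenProduct i) m k (evenProduct-vanishesInJ i m k lt))

  evenProduct-monic : ∀ i → coeff (evenProduct i) (i ℕ.* 2) 0 ≡ 1ℚ
  evenProduct-monic zero    = refl
  evenProduct-monic (suc i) = begin
    coeff (evenProduct (suc i)) (suc i ℕ.* 2) 0
      ≡⟨ coeff-⊕ (b⊛ b⊛ evenProduct i) ((- (fromℕ i * fromℕ i)) ⊙ evenProduct i) (suc i ℕ.* 2) 0 ⟩
    coeff (evenProduct i) (i ℕ.* 2) 0 + coeff ((- (fromℕ i * fromℕ i)) ⊙ evenProduct i) (suc i ℕ.* 2) 0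
      ≡⟨ cong₂ _+_ (evenProduct-monic i)
           (coeff-⊙-0 (- (fromℕ i * fromℕ i)) (evenProduct i) (suc i ℕ.* 2) 0
             (evenProduct-vanishesInB i _ 0 (ℕ.m<n+m (i ℕ.* 2) (s≤s z≤n)))) ⟩
    1ℚ + 0ℚ ∎

  -- The monomials b^{2d} and j^d witness that the bounds 2d and d on the degrees are attained.
  record Leading (d : ℕ) (P : Poly₂) : Set where
    field
      vanishesInB : VanishesAboveInB (d ℕ.* 2) P
      vanishesInJ : VanishesAboveInJ d P
      leadInB     : Positive (coeff P (d ℕ.* 2) 0)
      leadInJ     : Positive (coeff P 0 d)
  open Leading

  one-leading : Leading 0 one
  one-leading = record
    { vanishesInB = one-vanishesInB
    ; vanishesInJ = one-vanishesInJ
    ; leadInB     = _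
    ; leadInJ     = _
    }

  positive-* : ∀ x y → Positive x → Positive y → Positive (x * y)
  positive-* x y px py = pos*pos⇒pos x {{px}} y {{py}}

  ⊙-leading : ∀ {d P} c → Positive c → Leading d P → Leading d (c ⊙ P)
  ⊙-leading {d} {P} c c>0 lp = record
    { vanishesInB = λ i k lt → coeff-⊙-0 c P i k (vanishesInB lp i k lt)
    ; vanishesInJ = λ i k lt → coeff-⊙-0 c P i k (vanishesInJ lp i k lt)
    ; leadInB     = subst Positive (sym (coeff-⊙ c P (d ℕ.* 2) 0)) (positive-* c (coeff P (d ℕ.* 2) 0) c>0 (leadInB lp))
    ; leadInJ     = subst Positive (sym (coeff-⊙ c P 0 d)) (positive-* c (coeff P 0 d) c>0 (leadInJ lp))
    }

  -- Both bounds for `Q` are strictly smaller, so the leading coefficients of `P` survive whatever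
  -- the sign of `c`; the constants `mixing` can be negative.
  ⊕-lower-leading : ∀ {d P Q} c → Leading (suc d) P → Leading d Q → Leading (suc d) (P ⊕ c ⊙ Q)
  ⊕-lower-leading {d} {P} {Q} c lp lq = record
    { vanishesInB = λ i k lt → coeff-⊕-0 P (c ⊙ Q) i k
        (vanishesInB lp i k lt)
        (coeff-⊙-0 c Q i k (vanishesInB lq i k (ℕ.<-trans 2d<2d+2 lt)))
    ; vanishesInJ = λ i k lt → coeff-⊕-0 P (c ⊙ Q) i k
        (vanishesInJ lp i k lt)
        (coeff-⊙-0 c Q i k (vanishesInJ lq i k (ℕ.<-trans (ℕ.n<1+n d) lt)))
    ; leadInB     = subst Positive (sym (top (suc d ℕ.* 2) 0 (vanishesInB lq _ 0 2d<2d+2))) (leadInB lp)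
    ; leadInJ     = subst Positive (sym (top 0 (suc d) (vanishesInJ lq 0 _ (ℕ.n<1+n d)))) (leadInJ lp)
    }
    where
    2d<2d+2 = ℕ.m<n+m (d ℕ.* 2) {2} (s≤s z≤n)
    top : ∀ i k → coeff Q i k ≡ 0ℚ → coeff (P ⊕ c ⊙ Q) i k ≡ coeff P i k
    top i k Q≡0 = begin
      coeff (P ⊕ c ⊙ Q) i k            ≡⟨ coeff-⊕ P (c ⊙ Q) i k ⟩
      coeff P i k + coeff (c ⊙ Q) i k  ≡⟨ cong (coeff P i k +_) (coeff-⊙-0 c Q i k Q≡0) ⟩
      coeff P i k + 0ℚ                 ≡⟨ +-identityʳ (coeff P i k) ⟩
      coeff P i k                      ∎

  -- The top power of b comes from `evenProduct`, which is monic. The top power of j comes from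
  -- multiplying the previous solution by j and by the positive factor i, so its coefficient is i!.
  basicSolution-leading : ∀ i → Leading i (basicSolution i)
  basicSolution-leading zero    = one-leading
  basicSolution-leading (suc i) = record
    { vanishesInB = λ m k lt → coeff-⊕-0 E (s ⊙ T) m k
        (evenProduct-vanishesInB (suc i) m k lt)
        (coeff-⊙-0 s T m k (T-vanishesInB m k (ℕ.<-trans 2i<2i+2 lt)))
    ; vanishesInJ = λ m k lt → coeff-⊕-0 E (s ⊙ T) m k
        (evenProduct-vanishesInJ (suc i) m k (ℕ.<-trans (s≤s z≤n) lt))
        (coeff-⊙-0 s T m k (coeff-⊕-0 (j⊛ basicSolution i) ((- s) ⊙ basicSolution i) m k
          (j⊛-vanishesInJ (basicSolution i) (vanishesInJ IH) m k lt)
          (coeff-⊙-0 (- s) (basicSolution i) m k (vanishesInJ IH m k (ℕ.<-trans (ℕ.n<1+n i) lt)))))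
    ; leadInB     = subst Positive (sym leadB) _
    ; leadInJ     = subst Positive (sym leadJ) (positive-* s (coeff (basicSolution i) 0 i) (fromℕ-suc-positive i) (leadInJ IH))
    }
    where
    IH = basicSolution-leading i
    E = evenProduct (suc i)
    s = fromℕ (suc i)
    T = (j⊛ basicSolution i) ⊕ (- s) ⊙ basicSolution i
    2i<2i+2 = ℕ.m<n+m (i ℕ.* 2) {2} (s≤s z≤n)
    T-vanishesInB : VanishesAboveInB (i ℕ.* 2) T
    T-vanishesInB m k lt = coeff-⊕-0 (j⊛ basicSolution i) ((- s) ⊙ basicSolution i) m k
      (j⊛-vanishesInB (basicSolution i) (vanishesInB IH) m k lt)
      (coeff-⊙-0 (- s) (basicSolution i) m k (vanishesInB IH m k lt))
    leadB : coeff (basicSolution (suc i)) (suc i ℕ.* 2) 0 ≡ 1ℚ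
    leadB = trans (coeff-⊕ E (s ⊙ T) _ 0)
      (cong₂ _+_ (evenProduct-monic (suc i)) (coeff-⊙-0 s T _ 0 (T-vanishesInB _ 0 2i<2i+2)))
    leadJ : coeff (basicSolution (suc i)) 0 (suc i) ≡ s * coeff (basicSolution i) 0 i
    leadJ = begin
      coeff (basicSolution (suc i)) 0 (suc i)
        ≡⟨ coeff-⊕ E (s ⊙ T) 0 (suc i) ⟩
      coeff E 0 (suc i) + coeff (s ⊙ T) 0 (suc i)
        ≡⟨ cong₂ _+_ (evenProduct-vanishesInJ (suc i) 0 (suc i) (s≤s z≤n)) (coeff-⊙ s T 0 (suc i)) ⟩
      0ℚ + s * coeff T 0 (suc i)
        ≡⟨ +-identityˡ _ ⟩
      s * coeff T 0 (suc i)
        ≡⟨ cong (s *_) (coeff-⊕ (j⊛ basicSolution i) ((- s) ⊙ basicSolution i) 0 (suc i)) ⟩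
      s * (coeff (j⊛ basicSolution i) 0 (suc i) + coeff ((- s) ⊙ basicSolution i) 0 (suc i))
        ≡⟨ cong (s *_) (cong₂ _+_ (coeff-j⊛-suc (basicSolution i) 0 i)
             (coeff-⊙-0 (- s) (basicSolution i) 0 (suc i) (vanishesInJ IH 0 (suc i) (ℕ.n<1+n i)))) ⟩
      s * (coeff (basicSolution i) 0 i + 0ℚ)
        ≡⟨ cong (s *_) (+-identityʳ _) ⟩
      s * coeff (basicSolution i) 0 i ∎

  solution-leading : ∀ i n → Leading (i ℕ.+ n) (solution i n)
  solution-leading i zero    = subst (λ d → Leading d (basicSolution i)) (sym (ℕ.+-identityʳ i)) (basicSolution-leading i)
  solution-leading i (suc n) = subst (λ d → Leading d (solution i (suc n))) (sym (ℕ.+-suc i n))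
    (⊕-lower-leading (mixing i n) (⊙-leading (fromℕ 4) _ (solution-leading (suc i) n)) (solution-leading i n))

  -- The weight as a product, and the normalised solution.

  -- norm p = (2p+1)!
  norm : ℕ → ℚ
  norm zero    = 1ℚ
  norm (suc p) = fromℕ (2 ℕ.+ p ℕ.* 2) * (fromℕ (3 ℕ.+ p ℕ.* 2) * norm p)

  norm-positive : ∀ p → Positive (norm p)
  norm-positive zero    = _
  norm-positive (suc p) =
    positive-* (fromℕ (2 ℕ.+ p ℕ.* 2)) (fromℕ (3 ℕ.+ p ℕ.* 2) * norm p) (fromℕ-suc-positive (1 ℕ.+ p ℕ.* 2))
      (positive-* (fromℕ (3 ℕ.+ p ℕ.* 2)) (norm p) (fromℕ-suc-positive (2 ℕ.+ p ℕ.* 2)) (norm-positive p))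

  fromℕ-*2 : ∀ n → fromℕ (n ℕ.* 2) ≡ fromℕ n + fromℕ n
  fromℕ-*2 n = trans (cong fromℕ (ℕ.*-comm n 2)) (fromℕ-2* n)

  fromℕ-2*+1 : ∀ n → fromℕ (2 ℕ.* n ℕ.+ 1) ≡ fromℕ n + fromℕ n + 1ℚ
  fromℕ-2*+1 n = trans (fromℕ-+ (2 ℕ.* n) 1) (cong (_+ 1ℚ) (fromℕ-2* n))

  -- The left side is a product of 2p + 1 consecutive integers centred at w = 2k + 1. Passing from p
  -- to p + 1 adds one factor at each end: `absorb` yields w + p + 1 and `raise` yields w - p - 1.
  norm-binom : ∀ p k → norm p * binom (2 ℕ.* k ℕ.+ 1 ℕ.+ p) (suc (p ℕ.* 2))
             ≡ (fromℕ k + fromℕ k + 1ℚ) * weightProduct p (fromℕ k)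
  norm-binom zero k = begin
    1ℚ * binom (2 ℕ.* k ℕ.+ 1 ℕ.+ 0) 1  ≡⟨ *-identityˡ _ ⟩
    binom (2 ℕ.* k ℕ.+ 1 ℕ.+ 0) 1       ≡⟨ cong fromℕ (nC1≡n (2 ℕ.* k ℕ.+ 1 ℕ.+ 0)) ⟩
    fromℕ (2 ℕ.* k ℕ.+ 1 ℕ.+ 0)         ≡⟨ cong fromℕ (ℕ.+-identityʳ (2 ℕ.* k ℕ.+ 1)) ⟩
    fromℕ (2 ℕ.* k ℕ.+ 1)               ≡⟨ fromℕ-2*+1 k ⟩
    fromℕ k + fromℕ k + 1ℚ              ≡⟨ *-identityʳ _ ⟨
    (fromℕ k + fromℕ k + 1ℚ) * 1ℚ       ∎
  norm-binom (suc p) k = begin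
    fromℕ (2 ℕ.+ D) * (fromℕ (3 ℕ.+ D) * norm p) * binom (U ℕ.+ suc p) (3 ℕ.+ D)
      ≡⟨ cong (λ m → fromℕ (2 ℕ.+ D) * (fromℕ (3 ℕ.+ D) * norm p) * binom m (3 ℕ.+ D)) (ℕ.+-suc U p) ⟩
    fromℕ (2 ℕ.+ D) * (fromℕ (3 ℕ.+ D) * norm p) * binom (suc M) (3 ℕ.+ D)
      ≡⟨ regroup₁ (fromℕ (2 ℕ.+ D)) (fromℕ (3 ℕ.+ D)) (norm p) (binom (suc M) (3 ℕ.+ D)) ⟩
    norm p * (fromℕ (2 ℕ.+ D) * (fromℕ (3 ℕ.+ D) * binom (suc M) (3 ℕ.+ D)))
      ≡⟨ cong (λ u → norm p * (fromℕ (2 ℕ.+ D) * u)) absorb ⟩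
    norm p * (fromℕ (2 ℕ.+ D) * ((fromℕ M + 1ℚ) * binom M (2 ℕ.+ D)))
      ≡⟨ regroup₂ (norm p) (fromℕ (2 ℕ.+ D)) (fromℕ M + 1ℚ) (binom M (2 ℕ.+ D)) ⟩
    norm p * ((fromℕ M + 1ℚ) * (fromℕ (2 ℕ.+ D) * binom M (2 ℕ.+ D)))
      ≡⟨ cong (λ u → norm p * ((fromℕ M + 1ℚ) * u)) raise ⟩
    norm p * ((fromℕ M + 1ℚ) * ((fromℕ M + - fromℕ (1 ℕ.+ D)) * binom M (1 ℕ.+ D)))
      ≡⟨ cong₂ (λ u v → norm p * ((u + 1ℚ) * ((u + - v) * binom M (1 ℕ.+ D)))) M-value D-value ⟩
    norm p * ((w + π + 1ℚ) * ((w + π + - (π + π + 1ℚ)) * binom M (1 ℕ.+ D)))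
      ≡⟨ regroup₃ (norm p) w π (binom M (1 ℕ.+ D)) ⟩
    norm p * binom M (1 ℕ.+ D) * (w * w + - ((π + 1ℚ) * (π + 1ℚ)))
      ≡⟨ cong₂ (λ u v → u * (w * w + - (v * v))) (norm-binom p k) (sym (fromℕ-suc p)) ⟩
    w * weightProduct p (fromℕ k) * (w * w + - (fromℕ (suc p) * fromℕ (suc p)))
      ≡⟨ *-assoc w (weightProduct p (fromℕ k)) _ ⟩
    w * weightProduct (suc p) (fromℕ k) ∎
    where
    D = p ℕ.* 2
    U = 2 ℕ.* k ℕ.+ 1
    M = U ℕ.+ p
    w = fromℕ k + fromℕ k + 1ℚ
    π = fromℕ p
    M-value : fromℕ M ≡ w + π
    M-value = trans (fromℕ-+ U p) (cong (_+ π) (fromℕ-2*+1 k))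
    D-value : fromℕ (1 ℕ.+ D) ≡ π + π + 1ℚ
    D-value = trans (fromℕ-suc D) (cong (_+ 1ℚ) (fromℕ-*2 p))
    absorb : fromℕ (3 ℕ.+ D) * binom (suc M) (3 ℕ.+ D) ≡ (fromℕ M + 1ℚ) * binom M (2 ℕ.+ D)
    absorb = trans (cong (_* binom (suc M) (3 ℕ.+ D)) (fromℕ-suc (2 ℕ.+ D))) (binom-absorb M (2 ℕ.+ D))
    raise : fromℕ (2 ℕ.+ D) * binom M (2 ℕ.+ D) ≡ (fromℕ M + - fromℕ (1 ℕ.+ D)) * binom M (1 ℕ.+ D)
    raise = trans (cong (_* binom M (2 ℕ.+ D)) (fromℕ-suc (1 ℕ.+ D))) (binom-raise M (1 ℕ.+ D))
    regroup₁ : ∀ a c n u → a * (c * n) * u ≡ n * (a * (c * u))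
    regroup₁ = solve-∀ ℚ-ring
    regroup₂ : ∀ n a c u → n * (a * (c * u)) ≡ n * (c * (a * u))
    regroup₂ = solve-∀ ℚ-ring
    regroup₃ : ∀ n w π u → n * ((w + π + 1ℚ) * ((w + π + - (π + π + 1ℚ)) * u)) ≡ n * u * (w * w + - ((π + 1ℚ) * (π + 1ℚ)))
    regroup₃ = solve-∀ ℚ-ring

  norm-weight : ∀ p k → norm p * weight p k ≡ (fromℕ k + fromℕ k + 1ℚ) * weightProduct p (fromℕ k)
  norm-weight p k = trans
    (cong (λ d → norm p * binom (2 ℕ.* k ℕ.+ 1 ℕ.+ p) d) (trans (ℕ.+-comm (2 ℕ.* p) 1) (cong suc (ℕ.*-comm 2 p))))
    (norm-binom p k)

  norm⁻¹ : ℕ → ℚ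
  norm⁻¹ p = (1/ norm p) {{pos⇒nonZero (norm p) {{norm-positive p}}}}

  norm⁻¹-positive : ∀ p → Positive (norm⁻¹ p)
  norm⁻¹-positive p = 1/pos⇒pos (norm p) {{norm-positive p}}

  norm⁻¹*norm≡1 : ∀ p → norm⁻¹ p * norm p ≡ 1ℚ
  norm⁻¹*norm≡1 p = *-inverseˡ (norm p) {{pos⇒nonZero (norm p) {{norm-positive p}}}}

  -- The polynomial P in Q = (b + j) P. At i = 0 the product `shiftProduct` is 1, so only the weight
  -- is left on the right-hand side.
  cofactor : ℕ → Poly₂
  cofactor p = norm⁻¹ p ⊙ solution 0 p

  cofactor-leading : ∀ p → Leading p (cofactor p)
  cofactor-leading p = ⊙-leading (norm⁻¹ p) (norm⁻¹-positive p) (solution-leading 0 p)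

  gosper-cofactor : ∀ p k y → gosper (cofactor p) (fromℕ k) y ≡ weight p k
  gosper-cofactor p k y = begin
    gosper (cofactor p) (fromℕ k) y
      ≡⟨ gosper-⊙ (norm⁻¹ p) (solution 0 p) (fromℕ k) y ⟩
    norm⁻¹ p * gosper (solution 0 p) (fromℕ k) y
      ≡⟨ cong (norm⁻¹ p *_) (gosper-solution 0 p (fromℕ k) y) ⟩
    norm⁻¹ p * ((fromℕ k + fromℕ k + 1ℚ) * (1ℚ * weightProduct p (fromℕ k)))
      ≡⟨ cong (λ u → norm⁻¹ p * ((fromℕ k + fromℕ k + 1ℚ) * u)) (*-identityˡ (weightProduct p (fromℕ k))) ⟩
    norm⁻¹ p * ((fromℕ k + fromℕ k + 1ℚ) * weightProduct p (fromℕ k))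
      ≡⟨ cong (norm⁻¹ p *_) (norm-weight p k) ⟨
    norm⁻¹ p * (norm p * weight p k)
      ≡⟨ *-assoc (norm⁻¹ p) (norm p) (weight p k) ⟨
    norm⁻¹ p * norm p * weight p k
      ≡⟨ cong (_* weight p k) (norm⁻¹*norm≡1 p) ⟩
    1ℚ * weight p k
      ≡⟨ *-identityˡ (weight p k) ⟩
    weight p k ∎

  -- The polynomial `Q p` and the two summation identities.

  Q : ℕ → Poly₂
  Q p = (b⊛ cofactor p) ⊕ (j⊛ cofactor p)

  eval-Q : ∀ p x y → Q p ⟨ x , y ⟩ ≡ (x + y) * cofactor p ⟨ x , y ⟩
  eval-Q p x y = begin
    Q p ⟨ x , y ⟩
      ≡⟨ eval-⊕ (b⊛ cofactor p) (j⊛ cofactor p) x y ⟩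
    (b⊛ cofactor p) ⟨ x , y ⟩ + (j⊛ cofactor p) ⟨ x , y ⟩
      ≡⟨ cong₂ _+_ (eval-b⊛ (cofactor p) x y) (eval-j⊛ (cofactor p) x y) ⟩
    x * cofactor p ⟨ x , y ⟩ + y * cofactor p ⟨ x , y ⟩
      ≡⟨ *-distribʳ-+ (cofactor p ⟨ x , y ⟩) x y ⟨
    (x + y) * cofactor p ⟨ x , y ⟩ ∎

  Q-antidiagonal : ∀ p x → Q p ⟨ x , - x ⟩ ≡ 0ℚ
  Q-antidiagonal p x = begin
    Q p ⟨ x , - x ⟩                     ≡⟨ eval-Q p x (- x) ⟩
    (x + - x) * cofactor p ⟨ x , - x ⟩  ≡⟨ cong (_* cofactor p ⟨ x , - x ⟩) (+-inverseʳ x) ⟩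
    0ℚ * cofactor p ⟨ x , - x ⟩         ≡⟨ *-zeroˡ (cofactor p ⟨ x , - x ⟩) ⟩
    0ℚ                                  ∎

  -- The factor k + 1 + y of Q(k+1, y) meets t(k+1), and the ratio turns their product into a
  -- multiple of t(k); what multiplies t(k) is then `gosper (cofactor p)`. The ratio is in product
  -- form because k + 1 + y can be zero when y = -m.
  Q-telescopes : ∀ p y (t : ℕ → ℚ) →
    (∀ k → (fromℕ k + 1ℚ + y) * t (suc k) ≡ - (fromℕ k + 1ℚ + - y) * t k) →
    ∀ k → weight p k * t k ≡ t k * Q p ⟨ fromℕ k , y ⟩ + - (t (suc k) * Q p ⟨ fromℕ (suc k) , y ⟩)
  Q-telescopes p y t ratio k = sym (begin
    t k * Q p ⟨ x , y ⟩ + - (t (suc k) * Q p ⟨ fromℕ (suc k) , y ⟩)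
      ≡⟨ cong (λ z → t k * Q p ⟨ x , y ⟩ + - (t (suc k) * Q p ⟨ z , y ⟩)) (fromℕ-suc k) ⟩
    t k * Q p ⟨ x , y ⟩ + - (t (suc k) * Q p ⟨ x + 1ℚ , y ⟩)
      ≡⟨ cong₂ (λ u v → t k * u + - (t (suc k) * v)) (eval-Q p x y) (eval-Q p (x + 1ℚ) y) ⟩
    t k * ((x + y) * K₀) + - (t (suc k) * ((x + 1ℚ + y) * K₁))
      ≡⟨ regroup₁ x y (t k) (t (suc k)) K₀ K₁ ⟩
    t k * ((x + y) * K₀) + - ((x + 1ℚ + y) * t (suc k)) * K₁
      ≡⟨ cong (λ u → t k * ((x + y) * K₀) + - u * K₁) (ratio k) ⟩
    t k * ((x + y) * K₀) + - (- (x + 1ℚ + - y) * t k) * K₁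
      ≡⟨ regroup₂ x y (t k) K₀ K₁ ⟩
    gosper (cofactor p) x y * t k
      ≡⟨ cong (_* t k) (gosper-cofactor p k y) ⟩
    weight p k * t k ∎)
    where
    x = fromℕ k
    K₀ = cofactor p ⟨ x , y ⟩
    K₁ = cofactor p ⟨ x + 1ℚ , y ⟩
    regroup₁ : ∀ x y t t′ u v → t * ((x + y) * u) + - (t′ * ((x + 1ℚ + y) * v)) ≡ t * ((x + y) * u) + - ((x + 1ℚ + y) * t′) * v
    regroup₁ = solve-∀ ℚ-ring
    regroup₂ : ∀ x y t u v → t * ((x + y) * u) + - (- (x + 1ℚ + - y) * t) * v ≡ ((x + y) * u + (x + 1ℚ + - y) * v) * t
    regroup₂ = solve-∀ ℚ-ring

  Q-first : ∀ p → FirstIdentity p (Q p)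
  Q-first p b j@(suc j-1) b<j = begin
    ∑[ b , j ⟩ (λ k → weight p k * t k)
      ≡⟨ ∑-telescope F (λ k → weight p k * t k) (Q-telescopes p (fromℕ j) t ratio) (ℕ.<⇒≤ b<j) ⟩
    F b + - (t j * Q p ⟨ fromℕ j , fromℕ j ⟩)
      ≡⟨ cong (λ u → F b + - (u * Q p ⟨ fromℕ j , fromℕ j ⟩)) (binom≡0 n<2j) ⟩
    F b + - (0ℚ * Q p ⟨ fromℕ j , fromℕ j ⟩)
      ≡⟨ drop (F b) (Q p ⟨ fromℕ j , fromℕ j ⟩) ⟩
    F b ∎
    where
    -- As `j` is a successor, `suc n` reduces to `2 ℕ.* j`; both `n<2j` and `n-value` rely on this.
    n = 2 ℕ.* j ∸ 1
    t F : ℕ → ℚ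
    t k = binom n (j ℕ.+ k)
    F k = t k * Q p ⟨ fromℕ k , fromℕ j ⟩
    n<2j : n < j ℕ.+ j
    n<2j = s≤s (ℕ.≤-reflexive (cong (j-1 ℕ.+_) (ℕ.+-identityʳ j)))
    n-value : fromℕ n ≡ fromℕ j + fromℕ j + - 1ℚ
    n-value = begin
      fromℕ n                   ≡⟨ pad (fromℕ n) ⟩
      fromℕ n + 1ℚ + - 1ℚ       ≡⟨ cong (_+ - 1ℚ) (fromℕ-suc n) ⟨
      fromℕ (2 ℕ.* j) + - 1ℚ    ≡⟨ cong (_+ - 1ℚ) (fromℕ-2* j) ⟩
      fromℕ j + fromℕ j + - 1ℚ  ∎
      where
      pad : ∀ x → x ≡ x + 1ℚ + - 1ℚ
      pad = solve-∀ ℚ-ring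
    ratio : ∀ k → (fromℕ k + 1ℚ + fromℕ j) * t (suc k) ≡ - (fromℕ k + 1ℚ + - fromℕ j) * t k
    ratio k = begin
      (fromℕ k + 1ℚ + fromℕ j) * t (suc k)
        ≡⟨ cong₂ _*_ (regroup₁ (fromℕ k) (fromℕ j)) (cong (binom n) (ℕ.+-suc j k)) ⟩
      (fromℕ j + fromℕ k + 1ℚ) * binom n (suc (j ℕ.+ k))
        ≡⟨ cong (λ u → (u + 1ℚ) * binom n (suc (j ℕ.+ k))) (fromℕ-+ j k) ⟨
      (fromℕ (j ℕ.+ k) + 1ℚ) * binom n (suc (j ℕ.+ k))
        ≡⟨ binom-raise n (j ℕ.+ k) ⟩
      (fromℕ n + - fromℕ (j ℕ.+ k)) * t k
        ≡⟨ cong₂ (λ u v → (u + - v) * t k) n-value (fromℕ-+ j k) ⟩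
      (fromℕ j + fromℕ j + - 1ℚ + - (fromℕ j + fromℕ k)) * t k
        ≡⟨ cong (_* t k) (regroup₂ (fromℕ k) (fromℕ j)) ⟩
      - (fromℕ k + 1ℚ + - fromℕ j) * t k ∎
      where
      regroup₁ : ∀ x y → x + 1ℚ + y ≡ y + x + 1ℚ
      regroup₁ = solve-∀ ℚ-ring
      regroup₂ : ∀ x y → y + y + - 1ℚ + - (y + x) ≡ - (x + 1ℚ + - y)
      regroup₂ = solve-∀ ℚ-ring
    drop : ∀ u v → u + - (0ℚ * v) ≡ u
    drop = solve-∀ ℚ-ring

  Q-second : ∀ p → SecondIdentity p (Q p)
  Q-second p b m m<b = begin
    ∑[ m , b ⟩ (λ k → weight p k * ([-1]^ (k ℕ.+ m)) * binom (k ℕ.+ m) (2 ℕ.* m))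
      ≡⟨ ∑-telescope F _ step (ℕ.<⇒≤ m<b) ⟩
    t m * Q p ⟨ fromℕ m , - fromℕ m ⟩ + - F b
      ≡⟨ cong (λ u → t m * u + - F b) (Q-antidiagonal p (fromℕ m)) ⟩
    t m * 0ℚ + - F b
      ≡⟨ drop (t m) (F b) ⟩
    - F b ∎
    where
    t F : ℕ → ℚ
    t k = [-1]^ (k ℕ.+ m) * binom (k ℕ.+ m) (2 ℕ.* m)
    F k = t k * Q p ⟨ fromℕ k , - fromℕ m ⟩
    -- The double negation results from putting y = -m in the ratio required by `Q-telescopes`.
    ratio : ∀ k → (fromℕ k + 1ℚ + - fromℕ m) * t (suc k) ≡ - (fromℕ k + 1ℚ + - - fromℕ m) * t k
    ratio k = begin
      (x + 1ℚ + - μ) * ([-1]^ suc N * binom (suc N) (2 ℕ.* m))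
        ≡⟨ cong (λ u → (x + 1ℚ + - μ) * (u * binom (suc N) (2 ℕ.* m))) ([-1]^-suc N) ⟩
      (x + 1ℚ + - μ) * (- 1ℚ * [-1]^ N * binom (suc N) (2 ℕ.* m))
        -- Writing k + 1 - m as (k + m) + 1 - 2m brings the factor into the form of `binom-extend`,
        -- and the alternating sign supplies the minus of the ratio.
        ≡⟨ regroup₁ x μ ([-1]^ N) (binom (suc N) (2 ℕ.* m)) ⟩
      - [-1]^ N * ((x + μ + 1ℚ + - (μ + μ)) * binom (suc N) (2 ℕ.* m))
        ≡⟨ cong₂ (λ u v → - [-1]^ N * ((u + 1ℚ + - v) * binom (suc N) (2 ℕ.* m))) (fromℕ-+ k m) (fromℕ-2* m) ⟨
      - [-1]^ N * ((fromℕ N + 1ℚ + - fromℕ (2 ℕ.* m)) * binom (suc N) (2 ℕ.* m))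
        ≡⟨ cong (- [-1]^ N *_) (binom-extend N (2 ℕ.* m)) ⟩
      - [-1]^ N * ((fromℕ N + 1ℚ) * binom N (2 ℕ.* m))
        ≡⟨ cong (λ u → - [-1]^ N * ((u + 1ℚ) * binom N (2 ℕ.* m))) (fromℕ-+ k m) ⟩
      - [-1]^ N * ((x + μ + 1ℚ) * binom N (2 ℕ.* m))
        ≡⟨ regroup₂ x μ ([-1]^ N) (binom N (2 ℕ.* m)) ⟩
      - (x + 1ℚ + - - μ) * ([-1]^ N * binom N (2 ℕ.* m)) ∎
      where
      x = fromℕ k
      μ = fromℕ m
      N = k ℕ.+ m
      regroup₁ : ∀ x μ s u → (x + 1ℚ + - μ) * (- 1ℚ * s * u) ≡ - s * ((x + μ + 1ℚ + - (μ + μ)) * u)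
      regroup₁ = solve-∀ ℚ-ring
      regroup₂ : ∀ x μ s u → - s * ((x + μ + 1ℚ) * u) ≡ - (x + 1ℚ + - - μ) * (s * u)
      regroup₂ = solve-∀ ℚ-ring
    step : ∀ k → weight p k * ([-1]^ (k ℕ.+ m)) * binom (k ℕ.+ m) (2 ℕ.* m) ≡ F k + - F (suc k)
    step k = trans
      (*-assoc (weight p k) ([-1]^ (k ℕ.+ m)) (binom (k ℕ.+ m) (2 ℕ.* m)))
      (Q-telescopes p (- fromℕ m) t ratio k)
    drop : ∀ u v → u * 0ℚ + - v ≡ - v
    drop = solve-∀ ℚ-ring

  -- Uniqueness and exact degrees.

  -- For b > m we have 2m ≤ b + m, so the sign and the binomial in front of the polynomial are
  -- nonzero and cancel. This fixes the values at the points required by `eval-injective`.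
  second-unique : ∀ p P P′ → SecondIdentity p P → SecondIdentity p P′ → P ≈ P′
  second-unique p P P′ second second′ = eval-injective P P′ agree
    where
    agree : ∀ m n → P ⟨ fromℕ (suc m ℕ.+ n) , - fromℕ m ⟩ ≡ P′ ⟨ fromℕ (suc m ℕ.+ n) , - fromℕ m ⟩
    agree m n = *-cancelˡ-≢0 B (binom≢0 2m≤b+m) (*-cancelˡ-≢0 s ([-1]^≢0 (b ℕ.+ m))
      (begin
        s * (B * P ⟨ fromℕ b , - fromℕ m ⟩)   ≡⟨ *-assoc s B _ ⟨
        s * B * P ⟨ fromℕ b , - fromℕ m ⟩     ≡⟨ neg-injective (trans (sym (second b m m<b)) (second′ b m m<b)) ⟩
        s * B * P′ ⟨ fromℕ b , - fromℕ m ⟩    ≡⟨ *-assoc s B _ ⟩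
        s * (B * P′ ⟨ fromℕ b , - fromℕ m ⟩)  ∎))
      where
      b = suc m ℕ.+ n
      s = [-1]^ (b ℕ.+ m)
      B = binom (b ℕ.+ m) (2 ℕ.* m)
      m<b : m < b
      m<b = ℕ.m≤m+n (suc m) n
      2m≤b+m : 2 ℕ.* m ≤ b ℕ.+ m
      2m≤b+m = ℕ.≤-trans (ℕ.≤-reflexive (cong (m ℕ.+_) (ℕ.+-identityʳ m))) (ℕ.+-monoˡ-≤ m (ℕ.<⇒≤ m<b))

  -- The witness is the monomial with b to the power 2p + 1 and j to the power 0: it receives the
  -- leading coefficient of b P, and j P has no term free of j.
  Q-degreeInB : ∀ p → DegreeInB (Q p) (2 ℕ.* p ℕ.+ 1)
  Q-degreeInB p = subst (DegreeInB (Q p)) (sym (trans (ℕ.+-comm (2 ℕ.* p) 1) (cong suc (ℕ.*-comm 2 p))))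
    ( (0 , λ eq → positive⇒≢0 _ (leadInB (cofactor-leading p)) (trans (sym lead) eq))
    , λ i k lt → coeff-⊕-0 (b⊛ cofactor p) (j⊛ cofactor p) i k
        (b⊛-vanishesInB (cofactor p) (vanishesInB (cofactor-leading p)) i k lt)
        (j⊛-vanishesInB (cofactor p) (vanishesInB (cofactor-leading p)) i k (ℕ.<-trans (ℕ.n<1+n (p ℕ.* 2)) lt)) )
    where
    lead : coeff (Q p) (suc (p ℕ.* 2)) 0 ≡ coeff (cofactor p) (p ℕ.* 2) 0
    lead = begin
      coeff (Q p) (suc (p ℕ.* 2)) 0
        ≡⟨ coeff-⊕ (b⊛ cofactor p) (j⊛ cofactor p) (suc (p ℕ.* 2)) 0 ⟩
      coeff (cofactor p) (p ℕ.* 2) 0 + coeff (j⊛ cofactor p) (suc (p ℕ.* 2)) 0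
        ≡⟨ cong (coeff (cofactor p) (p ℕ.* 2) 0 +_) (coeff-j⊛-zero (cofactor p) (suc (p ℕ.* 2))) ⟩
      coeff (cofactor p) (p ℕ.* 2) 0 + 0ℚ
        ≡⟨ +-identityʳ _ ⟩
      coeff (cofactor p) (p ℕ.* 2) 0 ∎

  -- The witness is the pure power of j with exponent p + 1: it receives the leading coefficient of
  -- j P, and b P has no term free of b.
  Q-degreeInJ : ∀ p → DegreeInJ (Q p) (p ℕ.+ 1)
  Q-degreeInJ p = subst (DegreeInJ (Q p)) (ℕ.+-comm 1 p)
    ( (0 , λ eq → positive⇒≢0 _ (leadInJ (cofactor-leading p)) (trans (sym lead) eq))
    , λ i k lt → coeff-⊕-0 (b⊛ cofactor p) (j⊛ cofactor p) i k
        (b⊛-vanishesInJ (cofactor p) (vanishesInJ (cofactor-leading p)) i k (ℕ.<-trans (ℕ.n<1+n p) lt))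
        (j⊛-vanishesInJ (cofactor p) (vanishesInJ (cofactor-leading p)) i k lt) )
    where
    lead : coeff (Q p) 0 (suc p) ≡ coeff (cofactor p) 0 p
    lead = begin
      coeff (Q p) 0 (suc p)                 ≡⟨ coeff-⊕ (b⊛ cofactor p) (j⊛ cofactor p) 0 (suc p) ⟩
      0ℚ + coeff (j⊛ cofactor p) 0 (suc p)  ≡⟨ +-identityˡ _ ⟩
      coeff (j⊛ cofactor p) 0 (suc p)       ≡⟨ coeff-j⊛-suc (cofactor p) 0 p ⟩
      coeff (cofactor p) 0 p                ∎

  degreeInB-cong : ∀ P P′ {d} → P ≈ P′ → DegreeInB P d → DegreeInB P′ d
  degreeInB-cong P P′ {d} P≈P′ ((k , lead) , van) =
    (k , λ eq → lead (trans (P≈P′ d k) eq)) , λ i k lt → trans (sym (P≈P′ i k)) (van i k lt)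

  degreeInJ-cong : ∀ P P′ {d} → P ≈ P′ → DegreeInJ P d → DegreeInJ P′ d
  degreeInJ-cong P P′ {d} P≈P′ ((i , lead) , van) =
    (i , λ eq → lead (trans (P≈P′ i d) eq)) , λ i k lt → trans (sym (P≈P′ i k)) (van i k lt)

open import Defs
open import Data.Nat.Base using (ℕ; _+_; _*_)
open import Data.Rational.Base using (ℚ; 0ℚ; -_)
open import Data.Product using (∃!; _×_; _,_)
open import Relation.Binary.PropositionalEquality using (_≡_; sym; trans)
open Construction

lemma7 : ∀ (p : ℕ) →
    ∃! _≈_ (λ Q → FirstIdentity p Q × SecondIdentity p Q)
    × (∀ (Q : Poly₂) → FirstIdentity p Q × SecondIdentity p Q →
         DegreeInB Q (2 * p + 1)
         × DegreeInJ Q (p + 1)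
         × (∀ (x : ℚ) → Q ⟨ x , - x ⟩ ≡ 0ℚ))
lemma7 p =
  (Q p , (Q-first p , Q-second p) , λ {P} (_ , second) → second-unique p (Q p) P (Q-second p) second) ,
  λ P (_ , second) →
    -- An arbitrary solution has the same coefficients as `Q p`, so the degrees transfer
    -- coefficientwise and the zero at j = -b transfers through `eval-cong`.
    let Q≈P = second-unique p (Q p) P (Q-second p) second in
    degreeInB-cong (Q p) P Q≈P (Q-degreeInB p) ,
    degreeInJ-cong (Q p) P Q≈P (Q-degreeInJ p) ,
    λ x → trans (sym (eval-cong (Q p) P Q≈P x (- x))) (Q-antidiagonal p x)
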